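{- For every integer $r\ge 1$, let $f_d(r)$ denote the number of $d$-dimensional faces of the Kostka polytope $P_r$. Then $$f_1(r)=\binom{r}{6}+2\binom{r}{5}+6\binom{r}{4}+7\binom{r}{3}+3\binom{r}{2},$$ $$f_2(r)=\binom{r}{9}+3\binom{r}{8}+12\binom{r}{7}+23\binom{r}{6}+33\binom{r}{5}+31\binom{r}{4}+13\binom{r}{3}+\binom{r}{2},$$ $$f_3(r)=\binom{r}{12}+4\binom{r}{11}+19\binom{r}{10}+49\binom{r}{9}+105\binom{r}{8}+163\binom{r}{7}+177\binom{r}{6}+131\binom{r}{5}+53\binom{r}{4}+7\binom{r}{3}.$$
   Context: For a positive integer $r$, a partition with at most $r$ parts is written as a non-increasing $r$-tuple of nonnegative integers; $\mathrm{Par}_r(n)$ is the set of such tuples with entries summing to $n$. For $\lambda,\mu\in\mathrm{Par}_r(n)$, $\lambda$ dominates $\mu$ if $\sum_{i=1}^k\lambda_i\ge\sum_{i=1}^k\mu_i$ for all $k\le r$. The $r$-Kostka cone $\mathcal{K}_r\subseteq\mathbb{R}^{2r}$ is the convex hull of all points $(\lambda_1,\dots,\lambda_r,\mu_1,\dots,\mu_r)$ with $\lambda,\mu\in\mathrm{Par}_r(n)$ for some $n$ and $\lambda$ dominating $\mu$; it is a pointed $(2r-1)$-dimensional polyhedral cone. The Kostka polytope $P_r$ is the $(2r-2)$-dimensional polytope $\mathcal{K}_r\cap\{x:\sum_{i=1}^r(\lambda_i+\mu_i)=1\}$.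
   Formalization: The Kostka polytope and its faces are taken in rational rather than real 2r-dimensional space: points, convex weights and the functionals exposing faces have rational coordinates. -}

module Defs where

open import Data.Nat as ℕ using (ℕ; zero; suc; _<ᵇ_)
open import Data.Integer using (+_)
open import Data.Rational as ℚ using (ℚ; 0ℚ; 1ℚ; _/_)
open import Data.Fin using (Fin; zero; suc; toℕ; _↑ˡ_; _↑ʳ_)
open import Data.Bool using (if_then_else_)
open import Data.Product using (Σ; ∃; _×_)
open import Relation.Binary.PropositionalEquality using (_≡_)
open import Relation.Nullary using (¬_)
open import Level using (0ℓ)

sumℕ : ∀ {n} → (Fin n → ℕ) → ℕ
sumℕ {zero} f = 0
sumℕ {suc n} f = f zero ℕ.+ sumℕ (λ i → f (suc i))

sumℚ : ∀ {n} → (Fin n → ℚ) → ℚ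
sumℚ {zero} f = 0ℚ
sumℚ {suc n} f = f zero ℚ.+ sumℚ (λ i → f (suc i))

partialSum : ∀ {r} → ℕ → (Fin r → ℕ) → ℕ
partialSum k f = sumℕ (λ i → if toℕ i <ᵇ k then f i else 0)

-- a partition with at most r parts: a non-increasing r-tuple of naturals
NonIncreasing : ∀ {r} → (Fin r → ℕ) → Set
NonIncreasing {r} f = (i j : Fin r) → toℕ i ℕ.≤ toℕ j → f j ℕ.≤ f i

Dominates : ∀ {r} → (Fin r → ℕ) → (Fin r → ℕ) → Set
Dominates {r} l m = (k : ℕ) → k ℕ.≤ r → partialSum k m ℕ.≤ partialSum k l

-- points of ℚ^{2r}; coordinates 0..r-1 are λ, r..2r-1 are μ
Pt : ℕ → Set
Pt r = Fin (r ℕ.+ r) → ℚ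

toℚ : ℕ → ℚ
toℚ n = (+ n) / 1

embed : ∀ {r} → (Fin r → ℕ) → (Fin r → ℕ) → Pt r
embed {r} l m i = go (Data.Fin.splitAt r i)
  where
  open import Data.Sum using (inj₁; inj₂)
  go : _ → ℚ
  go (inj₁ a) = toℚ (l a)
  go (inj₂ b) = toℚ (m b)

KostkaGenerator : (r : ℕ) → Pt r → Set
KostkaGenerator r x =
  Σ (Fin r → ℕ) λ l → Σ (Fin r → ℕ) λ m →
    NonIncreasing l × NonIncreasing m × sumℕ l ≡ sumℕ m × Dominates l m
    × ((i : Fin (r ℕ.+ r)) → x i ≡ embed l m i)

InConvexHull : ∀ {r} → (Pt r → Set) → Pt r → Set
InConvexHull {r} S x =
  Σ ℕ λ k → Σ (Fin k → Pt r) λ p → Σ (Fin k → ℚ) λ w →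
    ((j : Fin k) → 0ℚ ℚ.≤ w j) × sumℚ w ≡ 1ℚ × ((j : Fin k) → S (p j))
    × ((i : Fin (r ℕ.+ r)) → x i ≡ sumℚ (λ j → w j ℚ.* p j i))

KostkaCone : (r : ℕ) → Pt r → Set
KostkaCone r = InConvexHull {r} (KostkaGenerator r)

KostkaPolytope : (r : ℕ) → Pt r → Set
KostkaPolytope r x = KostkaCone r x × sumℚ {r ℕ.+ r} x ≡ 1ℚ

dot : ∀ {r} → Pt r → Pt r → ℚ
dot {r} c x = sumℚ {r ℕ.+ r} (λ i → c i ℚ.* x i)

Face : (r : ℕ) → Pt r → Pt r → Set
Face r c x = KostkaPolytope r x × ((y : Pt r) → KostkaPolytope r y → dot {r} c y ℚ.≤ dot {r} c x)

AffinelyIndependent : ∀ {r m} → (Fin (suc m) → Pt r) → Set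
AffinelyIndependent {r} {m} p =
  (a : Fin (suc m) → ℚ) → sumℚ a ≡ 0ℚ →
  ((i : Fin (r ℕ.+ r)) → sumℚ (λ j → a j ℚ.* p j i) ≡ 0ℚ) →
  (j : Fin (suc m)) → a j ≡ 0ℚ

HasAffineDim : ∀ {r} → (Pt r → Set) → ℕ → Set
HasAffineDim {r} F d =
  (Σ (Fin (suc d) → Pt r) λ p → ((j : Fin (suc d)) → F (p j)) × AffinelyIndependent {r} p)
  × ¬ (Σ (Fin (suc (suc d)) → Pt r) λ p → ((j : Fin (suc (suc d))) → F (p j)) × AffinelyIndependent {r} p)

IsDFace : (r d : ℕ) → Pt r → Set
IsDFace r d c = HasAffineDim {r} (Face r c) d

SameFace : (r : ℕ) → Pt r → Pt r → Set
SameFace r c c' = (x : Pt r) → (Face r c x → Face r c' x) × (Face r c' x → Face r c x)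

NumDFaces : (r d N : ℕ) → Set
NumDFaces r d N =
  Σ (Fin N → Pt r) λ cs →
    ((i : Fin N) → IsDFace r d (cs i))
    × ((i j : Fin N) → SameFace r (cs i) (cs j) → i ≡ j)
    × ((c : Pt r) → IsDFace r d c → ∃ λ i → SameFace r c (cs i))

{-# OPTIONS --safe #-}
-- Put aᵢ = λᵢ − λᵢ₊₁, bᵢ = μᵢ − μᵢ₊₁ and Dᵢ = Σ_{j ≤ i} (λⱼ − μⱼ).  The cone is given by
-- a, b, D ≥ 0 and D₀ = Dᵣ = 0, and aᵢ − bᵢ = 2 Dᵢ − Dᵢ₋₁ − Dᵢ₊₁.  A face is determined by
-- the support of (a, b, D) at a relative interior point, and the possible supports are
-- the words of length r accepted by a three-state automaton.  The dimension of the cone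
-- over the face is the number of i with aᵢ > 0 plus the number of i with bᵢ, Dᵢ > 0:
-- these coordinates determine a point of the face, and deleting one of them at a time
-- yields a complete flag of faces.  Letters with a = b = 0 that keep the state cost
-- nothing, so the number of words of length r is Σₖ cₖ C(r, k), where cₖ counts the
-- words of length k without such letters.

module Submission where

open import Defs
open import Data.Bool using (Bool; true; false; _∧_; if_then_else_)
open import Data.Empty using (⊥-elim)
open import Data.Fin using (Fin; zero; suc; toℕ; splitAt; _↑ˡ_; _↑ʳ_)
import Data.Fin.Properties as FinP
import Data.Integer as ℤ
import Data.Integer.Properties as ℤP
open import Data.List using (List; []; _∷_; length; map; _++_; concatMap; foldr; lookup)
open import Data.List.Membership.Propositional using (_∈_)
import Data.List.Membership.Propositional.Properties as ∈P
open import Data.List.Properties using (length-map; length-++)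
open import Data.List.Relation.Binary.Pointwise using (Pointwise; []; _∷_)
open import Data.List.Relation.Unary.All as All using (All; []; _∷_)
import Data.List.Relation.Unary.All.Properties as AllP
open import Data.List.Relation.Unary.AllPairs using ([]; _∷_)
open import Data.List.Relation.Unary.Any as Any using (here; there; satisfied; index)
import Data.List.Relation.Unary.Any.Properties as AnyP
open import Data.List.Relation.Unary.Unique.Propositional using (Unique)
import Data.List.Relation.Unary.Unique.Propositional.Properties as UniqueP
open import Data.Nat as ℕ using (ℕ; zero; suc)
open import Data.Nat.Combinatorics using (_C_; nCk+nC[k+1]≡[n+1]C[k+1])
import Data.Nat.Coprimality as Coprime
open import Data.Nat.ListAction using (sum)
import Data.Nat.Properties as ℕP
open import Data.Nat.Solver using () renaming (module +-*-Solver to ℕ-Solver)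
open import Data.Product using (Σ; ∃; _×_; _,_; proj₁; proj₂)
open import Data.Rational as ℚ using (ℚ; 0ℚ; 1ℚ; ½; _+_; _*_; _-_; -_; _≤_; _<_; mkℚ)
open import Data.Rational.Properties as ℚP using (≤-refl; ≤-trans; <⇒≤; <-irrefl)
open import Data.Rational.Solver using (module +-*-Solver)
import Data.Rational.Unnormalised as ℚᵘ
open import Data.Sum using (_⊎_; inj₁; inj₂; [_,_]′)
open import Function using (_∘_)
open import Relation.Binary.Definitions using (tri<; tri≈; tri>)
open import Relation.Binary.PropositionalEquality
open import Relation.Nullary using (¬_; yes; no)

-- Faces are defined by arbitrary functionals, whereas words only see the inequalities a, b, D ≥ 0.
-- No duality theorem bridges this gap: the face of a word is exposed by an explicit functional, and
-- from a given functional the word is read off at a point of maximal support. Three states suffice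
-- because a - b is a second difference. Reading from the left, it is enough to remember whether D
-- is zero and, inside a block, whether a positive a has already allowed D to come down. A letter
-- need not be recognisable by itself: whether a block opens behind it may show only at the next
-- position. The counts are polynomials in r because the letters that cost nothing and keep the
-- state are the only free loops of the automaton; any other loop takes a peak or another letter of
-- positive cost. A unit of cost buys at most three further letters, those that open, peak and close
-- a block. Hence the top term for d-faces is C(r, 3(d + 1)) with coefficient 1, coming from d + 1
-- such blocks in a row.

-- Supports as words of an automaton

-- The words describing the supports: the i-th letter records which of the
-- numbers aᵢ, bᵢ, Dᵢ (kinds A, B, Δ) are positive.  In state Out the next D is 0;
-- In₀ and In₁ lie inside a block of positive D, before resp. after its first
-- positive a.  A block needs such an a, since otherwise D would be convex on it.
data State : Set where
  Out In₀ In₁ : State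

data Letter : State → Set where
  idle   : Bool → Letter Out
  open′  : Bool → Letter Out
  rise   : Bool → Letter In₀
  peak   : Bool → Letter In₀
  inside : Bool → Bool → Letter In₁
  close  : Bool → Letter In₁
  reopen : Bool → Letter In₁

target : ∀ {s} → Letter s → State
target (idle _) = Out
target (open′ _) = In₀
target (rise _) = In₀
target (peak _) = In₁
target (inside _ _) = In₁
target (close _) = Out
target (reopen _) = In₀

data Kind : Set where
  A B Δ : Kind

flag : ∀ {s} → Letter s → Kind → Bool
flag (idle p) A = p
flag (idle p) B = p
flag (idle p) Δ = false
flag (open′ p) A = p
flag (open′ p) B = true
flag (open′ p) Δ = false
flag (rise b) A = false
flag (rise b) B = b
flag (rise b) Δ = true
flag (peak b) A = true
flag (peak b) B = b
flag (peak b) Δ = true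
flag (inside a b) A = a
flag (inside a b) B = b
flag (inside a b) Δ = true
flag (close p) A = p
flag (close p) B = true
flag (close p) Δ = false
flag (reopen p) A = p
flag (reopen p) B = true
flag (reopen p) Δ = false

data Word : State → ℕ → Set where
  []  : Word Out 0
  _∷_ : ∀ {s n} (ℓ : Letter s) → Word (target ℓ) n → Word s (suc n)

flags : ∀ {s n} → Word s n → Kind → ℕ → Bool
flags [] t k = false
flags (ℓ ∷ w) t zero = flag ℓ t
flags (ℓ ∷ w) t (suc k) = flags w t k

bit : Bool → ℕ
bit true = 1
bit false = 0

-- On a block D solves a second-order boundary value problem, so a and b inside
-- blocks are free; outside them b is determined by a and D.
cost : ∀ {s} → Letter s → ℕ
cost ℓ = bit (flag ℓ A) ℕ.+ bit (flag ℓ B ∧ flag ℓ Δ)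

weight : ∀ {s n} → Word s n → ℕ
weight [] = 0
weight (ℓ ∷ w) = cost ℓ ℕ.+ weight w

-- A block may already be open at position 0, where D vanishes but there is no letter.
data Initial : State → Set where
  out : Initial Out
  in₀ : Initial In₀

-- The Δ flag of the first letter separates the two states, and a first letter exists because no
-- word from `In₀` is empty.
flags-Out≢In₀ : ∀ {n} (w : Word Out n) (w′ : Word In₀ n) → ¬ (∀ t k → flags w t k ≡ flags w′ t k)
flags-Out≢In₀ (idle _ ∷ w) (rise _ ∷ w′) h with h Δ 0
... | ()
flags-Out≢In₀ (idle _ ∷ w) (peak _ ∷ w′) h with h Δ 0
... | ()
flags-Out≢In₀ (open′ _ ∷ w) (rise _ ∷ w′) h with h Δ 0
... | ()
flags-Out≢In₀ (open′ _ ∷ w) (peak _ ∷ w′) h with h Δ 0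
... | ()

-- Flags do not determine a single letter: `idle true` and `open′ true` agree, as do `close p` and
-- `reopen p`. Such pairs lead to different states, which the next Δ flag reveals.
flags-injective : ∀ {s n} (w w′ : Word s n) → (∀ t k → flags w t k ≡ flags w′ t k) → w ≡ w′
flags-injective [] [] h = refl
flags-injective (idle p ∷ w) (idle q ∷ w′) h with h A 0
... | refl = cong (idle p ∷_) (flags-injective w w′ (λ t k → h t (suc k)))
flags-injective (open′ p ∷ w) (open′ q ∷ w′) h with h A 0
... | refl = cong (open′ p ∷_) (flags-injective w w′ (λ t k → h t (suc k)))
flags-injective (rise p ∷ w) (rise q ∷ w′) h with h B 0
... | refl = cong (rise p ∷_) (flags-injective w w′ (λ t k → h t (suc k)))
flags-injective (peak p ∷ w) (peak q ∷ w′) h with h B 0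
... | refl = cong (peak p ∷_) (flags-injective w w′ (λ t k → h t (suc k)))
flags-injective (inside p q ∷ w) (inside p′ q′ ∷ w′) h with h A 0 | h B 0
... | refl | refl = cong (inside p q ∷_) (flags-injective w w′ (λ t k → h t (suc k)))
flags-injective (close p ∷ w) (close q ∷ w′) h with h A 0
... | refl = cong (close p ∷_) (flags-injective w w′ (λ t k → h t (suc k)))
flags-injective (reopen p ∷ w) (reopen q ∷ w′) h with h A 0
... | refl = cong (reopen p ∷_) (flags-injective w w′ (λ t k → h t (suc k)))
flags-injective (idle p ∷ w) (open′ q ∷ w′) h = ⊥-elim (flags-Out≢In₀ w w′ (λ t k → h t (suc k)))
flags-injective (open′ p ∷ w) (idle q ∷ w′) h = ⊥-elim (flags-Out≢In₀ w′ w (λ t k → sym (h t (suc k))))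
flags-injective (close p ∷ w) (reopen q ∷ w′) h = ⊥-elim (flags-Out≢In₀ w w′ (λ t k → h t (suc k)))
flags-injective (reopen p ∷ w) (close q ∷ w′) h = ⊥-elim (flags-Out≢In₀ w′ w (λ t k → sym (h t (suc k))))
flags-injective (rise p ∷ w) (peak q ∷ w′) h with h A 0
... | ()
flags-injective (peak p ∷ w) (rise q ∷ w′) h with h A 0
... | ()
flags-injective (inside p q ∷ w) (close p′ ∷ w′) h with h Δ 0
... | ()
flags-injective (inside p q ∷ w) (reopen p′ ∷ w′) h with h Δ 0
... | ()
flags-injective (close p′ ∷ w) (inside p q ∷ w′) h with h Δ 0
... | ()
flags-injective (reopen p′ ∷ w) (inside p q ∷ w′) h with h Δ 0
... | ()

flags-beyond : ∀ {s n} (w : Word s n) t k → n ℕ.≤ k → flags w t k ≡ false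
flags-beyond [] t k h = refl
flags-beyond (ℓ ∷ w) t (suc k) (ℕ.s≤s h) = flags-beyond w t k h

idle-word : ∀ n → Word Out n
idle-word zero = []
idle-word (suc n) = idle false ∷ idle-word n

idle-word-flags : ∀ n t k → flags (idle-word n) t k ≡ false
idle-word-flags zero t k = refl
idle-word-flags (suc n) A zero = refl
idle-word-flags (suc n) B zero = refl
idle-word-flags (suc n) Δ zero = refl
idle-word-flags (suc n) t (suc k) = idle-word-flags n t k

idle-word-weight : ∀ n → weight (idle-word n) ≡ 0
idle-word-weight zero = refl
idle-word-weight (suc n) = idle-word-weight n

-- Subfaces and the removal of one unit of cost

-- w′ describes a proper subface of w.
record _⊏_ {s s′ n} (w′ : Word s′ n) (w : Word s n) : Set where
  constructor mk⊏
  field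
    ⊏-sub : ∀ t k → flags w t k ≡ false → flags w′ t k ≡ false
    ⊏-sep : Σ Kind λ t → Σ ℕ λ k → flags w t k ≡ true × flags w′ t k ≡ false

⊏-cons : ∀ {s s′ n} {ℓ : Letter s} {ℓ′ : Letter s′} {w : Word (target ℓ) n} {w′ : Word (target ℓ′) n} →
  (∀ t → flag ℓ t ≡ false → flag ℓ′ t ≡ false) → w′ ⊏ w → (ℓ′ ∷ w′) ⊏ (ℓ ∷ w)
⊏-cons {ℓ = ℓ} {ℓ′} {w} {w′} h (mk⊏ sub (t , k , p , q)) = mk⊏ sub′ (t , suc k , p , q)
  where
  sub′ : ∀ t k → flags (ℓ ∷ w) t k ≡ false → flags (ℓ′ ∷ w′) t k ≡ false
  sub′ t zero = h t
  sub′ t (suc k) = sub t k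

⊏-head : ∀ {s s′ n} {ℓ : Letter s} {ℓ′ : Letter s′} {w : Word (target ℓ) n} {w′ : Word (target ℓ′) n} →
  (∀ t → flag ℓ t ≡ false → flag ℓ′ t ≡ false) →
  (∀ t k → flags w t k ≡ false → flags w′ t k ≡ false) →
  (Σ Kind λ t → flag ℓ t ≡ true × flag ℓ′ t ≡ false) →
  (ℓ′ ∷ w′) ⊏ (ℓ ∷ w)
⊏-head {ℓ = ℓ} {ℓ′} {w} {w′} h sub (t , p , q) = mk⊏ sub′ (t , zero , p , q)
  where
  sub′ : ∀ t k → flags (ℓ ∷ w) t k ≡ false → flags (ℓ′ ∷ w′) t k ≡ false
  sub′ t zero = h t
  sub′ t (suc k) = sub t k

-- Words end in `Out`, and `peak` is the only way out of `In₀`.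
In₀-has-peak : ∀ {n} (w : Word In₀ n) → Σ ℕ λ k → flags w A k ≡ true
In₀-has-peak (rise b ∷ w) with In₀-has-peak w
... | k , e = suc k , e
In₀-has-peak (peak b ∷ w) = 0 , refl

idle-word-⊏ : ∀ {n} (w : Word In₀ n) → idle-word n ⊏ w
idle-word-⊏ {n} w with In₀-has-peak w
... | k , e = mk⊏ (λ t k _ → idle-word-flags n t k) (A , k , e , idle-word-flags n A k)

private
  -- Keeping the state `s` lets the smaller word follow the same letters as before. This is why a
  -- word from `In₀` needs weight two to be shrunk: its last peak cannot go.
  Smaller : ∀ {s n} → Word s n → ℕ → Set
  Smaller {s} {n} w m = Σ (Word s n) λ w′ → weight w′ ≡ m × w′ ⊏ w

-- Free letters are passed over until a flag can be switched off at a gain of one unit. Where both a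
-- and b count, b goes first, so that a peak keeps its a.
shrink-Out : ∀ {n m} (w : Word Out n) → weight w ≡ suc m → Smaller w m
shrink-In₁ : ∀ {n m} (w : Word In₁ n) → weight w ≡ suc m → Smaller w m
shrink-In₀ : ∀ {n m} (w : Word In₀ n) → weight w ≡ suc (suc m) → Smaller w (suc m)
-- An open block whose only cost is its peak is removed altogether.
shrink-block : ∀ {n m} (w : Word In₀ n) → weight w ≡ suc m →
  Smaller w m ⊎ m ≡ 0

shrink-block {m = zero} w e = inj₂ refl
shrink-block {m = suc m} w e = inj₁ (shrink-In₀ w e)

shrink-Out (idle true ∷ w) e =
  idle false ∷ w , ℕP.suc-injective e ,
  ⊏-head (λ { A () ; B () ; Δ _ → refl }) (λ t k e → e) (A , refl , refl)
shrink-Out (idle false ∷ w) e with shrink-Out w e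
... | w′ , e′ , h = idle false ∷ w′ , e′ , ⊏-cons (λ t x → x) h
shrink-Out (open′ true ∷ w) e =
  open′ false ∷ w , ℕP.suc-injective e ,
  ⊏-head (λ { A () ; B () ; Δ _ → refl }) (λ t k e → e) (A , refl , refl)
shrink-Out {suc n} (open′ false ∷ w) e with shrink-block w e
... | inj₁ (w′ , e′ , h) = open′ false ∷ w′ , e′ , ⊏-cons (λ t x → x) h
-- Nothing else is lost with the tail: a later block would cost a second peak.
... | inj₂ refl = idle false ∷ idle-word n , idle-word-weight n ,
  ⊏-cons (λ { A _ → refl ; B () ; Δ _ → refl }) (idle-word-⊏ w)

shrink-In₁ (inside true true ∷ w) e =
  inside true false ∷ w , ℕP.suc-injective e ,
  ⊏-head (λ { A () ; B () ; Δ () }) (λ t k e → e) (B , refl , refl)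
shrink-In₁ (inside true false ∷ w) e =
  inside false false ∷ w , ℕP.suc-injective e ,
  ⊏-head (λ { A () ; B _ → refl ; Δ () }) (λ t k e → e) (A , refl , refl)
shrink-In₁ (inside false true ∷ w) e =
  inside false false ∷ w , ℕP.suc-injective e ,
  ⊏-head (λ { A _ → refl ; B () ; Δ () }) (λ t k e → e) (B , refl , refl)
shrink-In₁ (inside false false ∷ w) e with shrink-In₁ w e
... | w′ , e′ , h = inside false false ∷ w′ , e′ , ⊏-cons (λ t x → x) h
shrink-In₁ (close true ∷ w) e =
  close false ∷ w , ℕP.suc-injective e ,
  ⊏-head (λ { A () ; B () ; Δ _ → refl }) (λ t k e → e) (A , refl , refl)
shrink-In₁ (close false ∷ w) e with shrink-Out w e
... | w′ , e′ , h = close false ∷ w′ , e′ , ⊏-cons (λ t x → x) h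
shrink-In₁ (reopen true ∷ w) e =
  reopen false ∷ w , ℕP.suc-injective e ,
  ⊏-head (λ { A () ; B () ; Δ _ → refl }) (λ t k e → e) (A , refl , refl)
shrink-In₁ {suc n} (reopen false ∷ w) e with shrink-block w e
... | inj₁ (w′ , e′ , h) = reopen false ∷ w′ , e′ , ⊏-cons (λ t x → x) h
... | inj₂ refl = close false ∷ idle-word n , idle-word-weight n ,
  ⊏-cons (λ { A _ → refl ; B () ; Δ _ → refl }) (idle-word-⊏ w)

shrink-In₀ (rise true ∷ w) e =
  rise false ∷ w , ℕP.suc-injective e ,
  ⊏-head (λ { A _ → refl ; B () ; Δ () }) (λ t k e → e) (B , refl , refl)
shrink-In₀ (rise false ∷ w) e with shrink-In₀ w e
... | w′ , e′ , h = rise false ∷ w′ , e′ , ⊏-cons (λ t x → x) h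
shrink-In₀ (peak true ∷ w) e =
  peak false ∷ w , ℕP.suc-injective e ,
  ⊏-head (λ { A () ; B () ; Δ () }) (λ t k e → e) (B , refl , refl)
-- The peak has to stay, so the unit is taken behind it; total weight at least two guarantees one
-- there.
shrink-In₀ (peak false ∷ w) e with shrink-In₁ w (ℕP.suc-injective e)
... | w′ , e′ , h = peak false ∷ w′ , cong suc e′ , ⊏-cons (λ t x → x) h

shrink : ∀ {s n m} → Initial s → (w : Word s n) → weight w ≡ suc (suc m) → Smaller w (suc m)
shrink out w e = shrink-Out w e
shrink in₀ w e = shrink-In₀ w e

-- Enumeration of the words of given length and weight

-- The free letter that keeps the state comes first, and the others follow in the order of the
-- summands in `coefficients`; the count by first letters relies on this order.
letters : ∀ s → List (Letter s)
letters Out = idle false ∷ idle true ∷ open′ false ∷ open′ true ∷ []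
letters In₀ = rise false ∷ rise true ∷ peak false ∷ peak true ∷ []
letters In₁ = inside false false ∷ inside false true ∷ inside true false ∷ inside true true
            ∷ close false ∷ close true ∷ reopen false ∷ reopen true ∷ []

letters-complete : ∀ {s} (ℓ : Letter s) → ℓ ∈ letters s
letters-complete (idle false) = here refl
letters-complete (idle true) = there (here refl)
letters-complete (open′ false) = there (there (here refl))
letters-complete (open′ true) = there (there (there (here refl)))
letters-complete (rise false) = here refl
letters-complete (rise true) = there (here refl)
letters-complete (peak false) = there (there (here refl))
letters-complete (peak true) = there (there (there (here refl)))
letters-complete (inside false false) = here refl
letters-complete (inside false true) = there (here refl)
letters-complete (inside true false) = there (there (here refl))
letters-complete (inside true true) = there (there (there (here refl)))
letters-complete (close false) = there (there (there (there (here refl))))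
letters-complete (close true) = there (there (there (there (there (here refl)))))
letters-complete (reopen false) = there (there (there (there (there (there (here refl))))))
letters-complete (reopen true) = there (there (there (there (there (there (there (here refl)))))))

letters-unique : ∀ s → Unique (letters s)
letters-unique Out =
    ((λ ()) ∷ (λ ()) ∷ (λ ()) ∷ []) ∷ ((λ ()) ∷ (λ ()) ∷ []) ∷ ((λ ()) ∷ []) ∷ [] ∷ []
letters-unique In₀ =
    ((λ ()) ∷ (λ ()) ∷ (λ ()) ∷ []) ∷ ((λ ()) ∷ (λ ()) ∷ []) ∷ ((λ ()) ∷ []) ∷ [] ∷ []
letters-unique In₁ =
    ((λ ()) ∷ (λ ()) ∷ (λ ()) ∷ (λ ()) ∷ (λ ()) ∷ (λ ()) ∷ (λ ()) ∷ [])
  ∷ ((λ ()) ∷ (λ ()) ∷ (λ ()) ∷ (λ ()) ∷ (λ ()) ∷ (λ ()) ∷ [])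
  ∷ ((λ ()) ∷ (λ ()) ∷ (λ ()) ∷ (λ ()) ∷ (λ ()) ∷ [])
  ∷ ((λ ()) ∷ (λ ()) ∷ (λ ()) ∷ (λ ()) ∷ [])
  ∷ ((λ ()) ∷ (λ ()) ∷ (λ ()) ∷ []) ∷ ((λ ()) ∷ (λ ()) ∷ []) ∷ ((λ ()) ∷ []) ∷ [] ∷ []

-- E (m − c), but empty if c > m.
lower : ∀ {X : Set} → ℕ → (ℕ → List X) → ℕ → List X
lower zero E m = E m
lower (suc c) E zero = []
lower (suc c) E (suc m) = lower c E m

words₀ : ∀ s → ℕ → List (Word s 0)
words₀ Out zero = [] ∷ []
words₀ Out (suc m) = []
words₀ In₀ m = []
words₀ In₁ m = []

words : ∀ s n → ℕ → List (Word s n)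
starting-with : ∀ {s} n → ℕ → Letter s → List (Word s (suc n))

words s zero m = words₀ s m
words s (suc n) m = concatMap (starting-with n m) (letters s)
starting-with n m ℓ = map (ℓ ∷_) (lower (cost ℓ) (words (target ℓ) n) m)

lower-∈⁻ : ∀ {X : Set} c (E : ℕ → List X) m {x} → x ∈ lower c E m → Σ ℕ λ m′ → c ℕ.+ m′ ≡ m × x ∈ E m′
lower-∈⁻ zero E m h = m , refl , h
lower-∈⁻ (suc c) E (suc m) h with lower-∈⁻ c E m h
... | m′ , e , h′ = m′ , cong suc e , h′

lower-∈⁺ : ∀ {X : Set} c (E : ℕ → List X) m {x} → x ∈ E m → x ∈ lower c E (c ℕ.+ m)
lower-∈⁺ zero E m h = h
lower-∈⁺ (suc c) E m h = lower-∈⁺ c E m h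

lower-unique : ∀ {X : Set} c (E : ℕ → List X) → (∀ m → Unique (E m)) → ∀ m → Unique (lower c E m)
lower-unique zero E h m = h m
lower-unique (suc c) E h zero = []
lower-unique (suc c) E h (suc m) = lower-unique c E h m

starting-with⁻ : ∀ {s} n m (ℓ : Letter s) {w} → w ∈ starting-with n m ℓ →
  Σ (Word (target ℓ) n) λ w′ → w ≡ ℓ ∷ w′ × (Σ ℕ λ m′ → cost ℓ ℕ.+ m′ ≡ m × w′ ∈ words (target ℓ) n m′)
starting-with⁻ n m ℓ h with ∈P.∈-map⁻ (ℓ ∷_) h
... | w′ , h′ , e = w′ , e , lower-∈⁻ (cost ℓ) (words (target ℓ) n) m h′

words-weight : ∀ s n m {w} → w ∈ words s n m → weight w ≡ m
words-weight Out zero zero (here refl) = refl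
words-weight s (suc n) m h with satisfied (∈P.∈-concatMap⁻ (starting-with n m) {xs = letters s} h)
... | ℓ , h′ with starting-with⁻ n m ℓ h′
... | w′ , refl , m′ , refl , h″ = cong (cost ℓ ℕ.+_) (words-weight (target ℓ) n m′ h″)

words-complete : ∀ {s n} (w : Word s n) → w ∈ words s n (weight w)
words-complete [] = here refl
words-complete {s} {suc n} (ℓ ∷ w) =
  ∈P.∈-concatMap⁺ (starting-with n (weight (ℓ ∷ w))) {xs = letters s}
    (Any.map (λ { refl → ∈P.∈-map⁺ (ℓ ∷_) (lower-∈⁺ (cost ℓ) (words (target ℓ) n) (weight w) (words-complete w)) })
      (letters-complete ℓ))

concatMap-unique : ∀ {X Y : Set} (f : X → List Y) {xs} → Unique xs → (∀ x → Unique (f x)) →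
  (∀ {x x′ y} → y ∈ f x → y ∈ f x′ → x ≡ x′) → Unique (concatMap f xs)
concatMap-unique f [] h d = []
concatMap-unique f {x ∷ xs} (x∉ ∷ u) h d =
  UniqueP.++⁺ (h x) (concatMap-unique f u h d) (λ {y} (p , q) → disjoint x∉ p (∈P.∈-concatMap⁻ f {xs = xs} q))
  where
  disjoint : ∀ {zs y} → All (x ≢_) zs → y ∈ f x → ¬ Any.Any (λ z → y ∈ f z) zs
  disjoint (ne ∷ _) p (here q) = ne (d p q)
  disjoint (_ ∷ r) p (there q) = disjoint r p q

private
  head-injective : ∀ {s n} {ℓ ℓ′ : Letter s} {w : Word (target ℓ) n} {w′ : Word (target ℓ′) n} →
    _≡_ {A = Word s (suc n)} (ℓ ∷ w) (ℓ′ ∷ w′) → ℓ ≡ ℓ′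
  head-injective refl = refl

  tail-injective : ∀ {s n} {ℓ : Letter s} {w w′ : Word (target ℓ) n} →
    _≡_ {A = Word s (suc n)} (ℓ ∷ w) (ℓ ∷ w′) → w ≡ w′
  tail-injective refl = refl

words-unique : ∀ s n m → Unique (words s n m)
words-unique Out zero zero = [] ∷ []
words-unique Out zero (suc m) = []
words-unique In₀ zero m = []
words-unique In₁ zero m = []
words-unique s (suc n) m = concatMap-unique (starting-with n m) (letters-unique s)
  (λ ℓ → UniqueP.map⁺ tail-injective (lower-unique (cost ℓ) (words (target ℓ) n) (words-unique (target ℓ) n) m))
  same-letter
  where
  same-letter : ∀ {ℓ ℓ′ w} → w ∈ starting-with n m ℓ → w ∈ starting-with n m ℓ′ → ℓ ≡ ℓ′
  same-letter {ℓ} {ℓ′} p q with starting-with⁻ n m ℓ p | starting-with⁻ n m ℓ′ q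
  ... | _ , e , _ | _ , e′ , _ = head-injective (trans (sym e) e′)

-- Counting words by binomial coefficients

-- Σₖ lₖ · C(n, i + k) for l = l₀ ∷ l₁ ∷ …
binomial-sum : ℕ → List ℕ → ℕ → ℕ
binomial-sum i [] n = 0
binomial-sum i (c ∷ l) n = c ℕ.* (n C i) ℕ.+ binomial-sum (suc i) l n

infixr 5 _⊕_
_⊕_ : List ℕ → List ℕ → List ℕ
[] ⊕ l = l
(c ∷ k) ⊕ [] = c ∷ k
(c ∷ k) ⊕ (d ∷ l) = (c ℕ.+ d) ∷ (k ⊕ l)

binomial-sum-⊕ : ∀ i k l n → binomial-sum i (k ⊕ l) n ≡ binomial-sum i k n ℕ.+ binomial-sum i l n
binomial-sum-⊕ i [] l n = refl
binomial-sum-⊕ i (c ∷ k) [] n = sym (ℕP.+-identityʳ _)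
binomial-sum-⊕ i (c ∷ k) (d ∷ l) n rewrite binomial-sum-⊕ (suc i) k l n =
  ℕ-Solver.solve 5 (λ c d x y z → (c :+ d) :* x :+ (y :+ z) := (c :* x :+ y) :+ (d :* x :+ z)) refl
    c d (n C i) (binomial-sum (suc i) k n) (binomial-sum (suc i) l n)
  where open ℕ-Solver

binomial-sum-pascal : ∀ i l n →
  binomial-sum (suc i) l (suc n) ≡ binomial-sum (suc i) l n ℕ.+ binomial-sum i l n
binomial-sum-pascal i [] n = refl
binomial-sum-pascal i (c ∷ l) n
  rewrite binomial-sum-pascal (suc i) l n | sym (nCk+nC[k+1]≡[n+1]C[k+1] n i) =
  ℕ-Solver.solve 5 (λ c x y u v → c :* (x :+ y) :+ (u :+ v) := (c :* y :+ u) :+ (c :* x :+ v)) refl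
    c (n C i) (n C suc i) (binomial-sum (suc (suc i)) l n) (binomial-sum (suc i) l n)
  where open ℕ-Solver

-- Pascal's rule as a recursion on the first letter: the first summand counts the words that begin
-- with the free letter keeping the state, the second those that begin with any other letter, with
-- coefficients shifted by one.
binomial-sum-suc : ∀ c l n → binomial-sum 0 (c ∷ l) (suc n) ≡ binomial-sum 0 (c ∷ l) n ℕ.+ binomial-sum 0 l n
binomial-sum-suc c l n rewrite binomial-sum-pascal 0 l n = sym (ℕP.+-assoc (c ℕ.* 1) _ _)

binomial-sum-zero : ∀ i l → binomial-sum (suc i) l 0 ≡ 0
binomial-sum-zero i [] = refl
binomial-sum-zero i (c ∷ l) rewrite ℕP.*-zeroʳ c = binomial-sum-zero (suc i) l

⨁ : List (List ℕ) → List ℕ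
⨁ = foldr _⊕_ []

binomial-sum-⨁ : ∀ ls n → binomial-sum 0 (⨁ ls) n ≡ sum (map (λ l → binomial-sum 0 l n) ls)
binomial-sum-⨁ [] n = refl
binomial-sum-⨁ (l ∷ ls) n =
  trans (binomial-sum-⊕ 0 l (⨁ ls) n) (cong (binomial-sum 0 l n ℕ.+_) (binomial-sum-⨁ ls n))

-- The k-th entry of coefficients s m counts the words of length k and weight m
-- from s without the letters `idle false`, `rise false`, `inside false false`.
-- These cost nothing and keep the state, so a word of length n arises from a
-- unique such word by choosing the k positions of its letters among n.
coefficients-In₀ coefficients-Out coefficients-In₁ : ℕ → List ℕ
coefficients-In₀ 0 = 0 ∷ []
coefficients-In₀ 1 = 0 ∷ ⨁ (coefficients-In₀ 0 ∷ coefficients-In₁ 0 ∷ [] ∷ [])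
coefficients-In₀ (suc (suc m)) =
  0 ∷ ⨁ (coefficients-In₀ (suc m) ∷ coefficients-In₁ (suc m) ∷ coefficients-In₁ m ∷ [])
coefficients-Out 0 = 1 ∷ ⨁ ([] ∷ coefficients-In₀ 0 ∷ [] ∷ [])
coefficients-Out (suc m) =
  0 ∷ ⨁ (coefficients-Out m ∷ coefficients-In₀ (suc m) ∷ coefficients-In₀ m ∷ [])
coefficients-In₁ 0 =
  0 ∷ ⨁ ([] ∷ [] ∷ [] ∷ coefficients-Out 0 ∷ [] ∷ coefficients-In₀ 0 ∷ [] ∷ [])
coefficients-In₁ 1 =
  0 ∷ ⨁ (coefficients-In₁ 0 ∷ coefficients-In₁ 0 ∷ [] ∷ coefficients-Out 1 ∷ coefficients-Out 0
         ∷ coefficients-In₀ 1 ∷ coefficients-In₀ 0 ∷ [])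
coefficients-In₁ (suc (suc m)) =
  0 ∷ ⨁ (coefficients-In₁ (suc m) ∷ coefficients-In₁ (suc m) ∷ coefficients-In₁ m
         ∷ coefficients-Out (suc (suc m)) ∷ coefficients-Out (suc m)
         ∷ coefficients-In₀ (suc (suc m)) ∷ coefficients-In₀ (suc m) ∷ [])

coefficients : State → ℕ → List ℕ
coefficients Out = coefficients-Out
coefficients In₀ = coefficients-In₀
coefficients In₁ = coefficients-In₁

length-concatMap : ∀ {X Y : Set} (f : X → List Y) xs → length (concatMap f xs) ≡ sum (map (length ∘ f) xs)
length-concatMap f [] = refl
length-concatMap f (x ∷ xs) = trans (length-++ (f x)) (cong (length (f x) ℕ.+_) (length-concatMap f xs))

length-words : ∀ s n m → length (words s n m) ≡ binomial-sum 0 (coefficients s m) n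
length-words Out zero zero = refl
length-words Out zero (suc m) = sym (binomial-sum-zero 0 (⨁ (coefficients-Out m ∷ coefficients-In₀ (suc m) ∷ coefficients-In₀ m ∷ [])))
length-words In₀ zero 0 = refl
length-words In₀ zero 1 = refl
length-words In₀ zero (suc (suc m)) = sym (binomial-sum-zero 0 (⨁ (coefficients-In₀ (suc m) ∷ coefficients-In₁ (suc m) ∷ coefficients-In₁ m ∷ [])))
length-words In₁ zero 0 = refl
length-words In₁ zero 1 = refl
length-words In₁ zero (suc (suc m)) =
  sym (binomial-sum-zero 0 (⨁ (coefficients-In₁ (suc m) ∷ coefficients-In₁ (suc m) ∷ coefficients-In₁ m
         ∷ coefficients-Out (suc (suc m)) ∷ coefficients-Out (suc m)
         ∷ coefficients-In₀ (suc (suc m)) ∷ coefficients-In₀ (suc m) ∷ [])))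
length-words s (suc n) m = trans (length-concatMap (starting-with n m) (letters s)) (step s m)
  where
  ih : ∀ s m → length (words s n m) ≡ binomial-sum 0 (coefficients s m) n
  ih s m = length-words s n m

  count-with : ∀ {s} m (ℓ : Letter s) {x} → length (lower (cost ℓ) (words (target ℓ) n) m) ≡ x →
    length (starting-with n m ℓ) ≡ x
  count-with m ℓ e = trans (length-map (ℓ ∷_) (lower (cost ℓ) (words (target ℓ) n) m)) e

  by-first-letter : ∀ s m c ls →
    Pointwise (λ ℓ l → length (starting-with n m ℓ) ≡ binomial-sum 0 l n) (letters s) ((c ∷ ⨁ ls) ∷ ls) →
    sum (map (length ∘ starting-with n m) (letters s)) ≡ binomial-sum 0 (c ∷ ⨁ ls) (suc n)
  by-first-letter s m c ls h = trans (sums h) (sym (trans (binomial-sum-suc c (⨁ ls) n)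
    (cong (binomial-sum 0 (c ∷ ⨁ ls) n ℕ.+_) (binomial-sum-⨁ ls n))))
    where
    sums : ∀ {ℓs ls} → Pointwise (λ ℓ l → length (starting-with {s} n m ℓ) ≡ binomial-sum 0 l n) ℓs ls →
      sum (map (length ∘ starting-with n m) ℓs) ≡ sum (map (λ l → binomial-sum 0 l n) ls)
    sums [] = refl
    sums (e ∷ h) = cong₂ ℕ._+_ e (sums h)

  step : ∀ s m → sum (map (length ∘ starting-with {s} n m) (letters s)) ≡ binomial-sum 0 (coefficients s m) (suc n)
  -- Here and below, `refl` belongs to a letter that costs more than the available weight: it starts
  -- no word, and its coefficient list is `[]`.
  step Out 0 = by-first-letter Out 0 1 ([] ∷ coefficients-In₀ 0 ∷ [] ∷ [])
    (count-with 0 (idle false) (ih Out 0) ∷ refl ∷ count-with 0 (open′ false) (ih In₀ 0) ∷ refl ∷ [])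
  step Out (suc m) = by-first-letter Out (suc m) 0 (coefficients-Out m ∷ coefficients-In₀ (suc m) ∷ coefficients-In₀ m ∷ [])
    (count-with (suc m) (idle false) (ih Out (suc m)) ∷ count-with (suc m) (idle true) (ih Out m)
      ∷ count-with (suc m) (open′ false) (ih In₀ (suc m)) ∷ count-with (suc m) (open′ true) (ih In₀ m) ∷ [])
  step In₀ 0 = by-first-letter In₀ 0 0 ([] ∷ [] ∷ [] ∷ [])
    (count-with 0 (rise false) (ih In₀ 0) ∷ refl ∷ refl ∷ refl ∷ [])
  step In₀ 1 = by-first-letter In₀ 1 0 (coefficients-In₀ 0 ∷ coefficients-In₁ 0 ∷ [] ∷ [])
    (count-with 1 (rise false) (ih In₀ 1) ∷ count-with 1 (rise true) (ih In₀ 0)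
      ∷ count-with 1 (peak false) (ih In₁ 0) ∷ refl ∷ [])
  step In₀ (suc (suc m)) = by-first-letter In₀ (suc (suc m)) 0
    (coefficients-In₀ (suc m) ∷ coefficients-In₁ (suc m) ∷ coefficients-In₁ m ∷ [])
    (count-with (2 ℕ.+ m) (rise false) (ih In₀ (2 ℕ.+ m)) ∷ count-with (2 ℕ.+ m) (rise true) (ih In₀ (suc m))
      ∷ count-with (2 ℕ.+ m) (peak false) (ih In₁ (suc m)) ∷ count-with (2 ℕ.+ m) (peak true) (ih In₁ m) ∷ [])
  step In₁ 0 = by-first-letter In₁ 0 0 ([] ∷ [] ∷ [] ∷ coefficients-Out 0 ∷ [] ∷ coefficients-In₀ 0 ∷ [] ∷ [])
    (count-with 0 (inside false false) (ih In₁ 0) ∷ refl ∷ refl ∷ refl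
      ∷ count-with 0 (close false) (ih Out 0) ∷ refl ∷ count-with 0 (reopen false) (ih In₀ 0) ∷ refl ∷ [])
  step In₁ 1 = by-first-letter In₁ 1 0
    (coefficients-In₁ 0 ∷ coefficients-In₁ 0 ∷ [] ∷ coefficients-Out 1 ∷ coefficients-Out 0
      ∷ coefficients-In₀ 1 ∷ coefficients-In₀ 0 ∷ [])
    (count-with 1 (inside false false) (ih In₁ 1) ∷ count-with 1 (inside false true) (ih In₁ 0)
      ∷ count-with 1 (inside true false) (ih In₁ 0) ∷ refl
      ∷ count-with 1 (close false) (ih Out 1) ∷ count-with 1 (close true) (ih Out 0)
      ∷ count-with 1 (reopen false) (ih In₀ 1) ∷ count-with 1 (reopen true) (ih In₀ 0) ∷ [])
  step In₁ (suc (suc m)) = by-first-letter In₁ (suc (suc m)) 0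
    (coefficients-In₁ (suc m) ∷ coefficients-In₁ (suc m) ∷ coefficients-In₁ m
      ∷ coefficients-Out (2 ℕ.+ m) ∷ coefficients-Out (suc m)
      ∷ coefficients-In₀ (2 ℕ.+ m) ∷ coefficients-In₀ (suc m) ∷ [])
    (count-with (2 ℕ.+ m) (inside false false) (ih In₁ (2 ℕ.+ m))
      ∷ count-with (2 ℕ.+ m) (inside false true) (ih In₁ (suc m))
      ∷ count-with (2 ℕ.+ m) (inside true false) (ih In₁ (suc m))
      ∷ count-with (2 ℕ.+ m) (inside true true) (ih In₁ m)
      ∷ count-with (2 ℕ.+ m) (close false) (ih Out (2 ℕ.+ m)) ∷ count-with (2 ℕ.+ m) (close true) (ih Out (suc m))
      ∷ count-with (2 ℕ.+ m) (reopen false) (ih In₀ (2 ℕ.+ m)) ∷ count-with (2 ℕ.+ m) (reopen true) (ih In₀ (suc m)) ∷ [])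

-- Starting states and the three polynomials

Start : ℕ → Set
Start r = Σ State λ s → Initial s × Word s r

from-Out : ∀ {r} → Word Out r → Start r
from-Out w = Out , out , w

from-In₀ : ∀ {r} → Word In₀ r → Start r
from-In₀ w = In₀ , in₀ , w

starts : ∀ r → ℕ → List (Start r)
starts r m = map from-Out (words Out r m) ++ map from-In₀ (words In₀ r m)

starts-weight : ∀ r m {s i w} → (s , i , w) ∈ starts r m → weight w ≡ m
starts-weight r m h with ∈P.∈-++⁻ (map from-Out (words Out r m)) h
... | inj₁ p with ∈P.∈-map⁻ from-Out p
...   | w , q , refl = words-weight Out r m q
starts-weight r m h | inj₂ p with ∈P.∈-map⁻ from-In₀ p
...   | w , q , refl = words-weight In₀ r m q

starts-complete : ∀ {r s} (i : Initial s) (w : Word s r) → (s , i , w) ∈ starts r (weight w)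
starts-complete out w = ∈P.∈-++⁺ˡ (∈P.∈-map⁺ _ (words-complete w))
starts-complete {r} in₀ w =
  ∈P.∈-++⁺ʳ (map from-Out (words Out r (weight w))) (∈P.∈-map⁺ _ (words-complete w))

starts-unique : ∀ r m → Unique (starts r m)
starts-unique r m = UniqueP.++⁺
  (UniqueP.map⁺ (λ { refl → refl }) (words-unique Out r m))
  (UniqueP.map⁺ (λ { refl → refl }) (words-unique In₀ r m))
  disjoint
  where
  disjoint : ∀ {x} → ¬ (x ∈ map from-Out (words Out r m) × x ∈ map from-In₀ (words In₀ r m))
  disjoint (p , q) with ∈P.∈-map⁻ from-Out p | ∈P.∈-map⁻ from-In₀ q
  ... | _ , _ , refl | _ , _ , ()

lookup-injective : ∀ {X : Set} {xs : List X} → Unique xs → ∀ i j → lookup xs i ≡ lookup xs j → i ≡ j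
lookup-injective (_ ∷ u) zero zero e = refl
lookup-injective (x∉ ∷ u) zero (suc j) e = ⊥-elim (All.lookup x∉ (∈P.∈-lookup j) e)
lookup-injective (x∉ ∷ u) (suc i) zero e = ⊥-elim (All.lookup x∉ (∈P.∈-lookup i) (sym e))
lookup-injective (_ ∷ u) (suc i) (suc j) e = cong suc (lookup-injective u i j e)

length-starts : ∀ r m → length (starts r m) ≡ binomial-sum 0 (coefficients Out m ⊕ coefficients In₀ m) r
length-starts r m = begin
  length (starts r m)
    ≡⟨ length-++ (map from-Out (words Out r m)) ⟩
  length (map from-Out (words Out r m)) ℕ.+ length (map from-In₀ (words In₀ r m))
    ≡⟨ cong₂ ℕ._+_ (length-map _ (words Out r m)) (length-map _ (words In₀ r m)) ⟩
  length (words Out r m) ℕ.+ length (words In₀ r m)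
    ≡⟨ cong₂ ℕ._+_ (length-words Out r m) (length-words In₀ r m) ⟩
  binomial-sum 0 (coefficients Out m) r ℕ.+ binomial-sum 0 (coefficients In₀ m) r
    ≡⟨ binomial-sum-⊕ 0 (coefficients Out m) (coefficients In₀ m) r ⟨
  binomial-sum 0 (coefficients Out m ⊕ coefficients In₀ m) r ∎
  where open ≡-Reasoning

-- Weight 2, because an edge spans a two-dimensional cone. The coefficient list is evaluated by
-- normalisation, and its zero entries vanish by computation.
count₁ : ∀ r → length (starts r 2) ≡
  r C 6 ℕ.+ 2 ℕ.* (r C 5) ℕ.+ 6 ℕ.* (r C 4) ℕ.+ 7 ℕ.* (r C 3) ℕ.+ 3 ℕ.* (r C 2)
count₁ r = trans (length-starts r 2)
  (solve 5 (λ c₂ c₃ c₄ c₅ c₆ →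
      con 3 :* c₂ :+ (con 7 :* c₃ :+ (con 6 :* c₄ :+ (con 2 :* c₅ :+ (con 1 :* c₆ :+ con 0))))
      := c₆ :+ con 2 :* c₅ :+ con 6 :* c₄ :+ con 7 :* c₃ :+ con 3 :* c₂)
    refl (r C 2) (r C 3) (r C 4) (r C 5) (r C 6))
  where open ℕ-Solver

count₂ : ∀ r → length (starts r 3) ≡
  r C 9 ℕ.+ 3 ℕ.* (r C 8) ℕ.+ 12 ℕ.* (r C 7) ℕ.+ 23 ℕ.* (r C 6) ℕ.+ 33 ℕ.* (r C 5)
  ℕ.+ 31 ℕ.* (r C 4) ℕ.+ 13 ℕ.* (r C 3) ℕ.+ r C 2
count₂ r = trans (length-starts r 3)
  (solve 8 (λ c₂ c₃ c₄ c₅ c₆ c₇ c₈ c₉ →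
      con 1 :* c₂ :+ (con 13 :* c₃ :+ (con 31 :* c₄ :+ (con 33 :* c₅ :+ (con 23 :* c₆
        :+ (con 12 :* c₇ :+ (con 3 :* c₈ :+ (con 1 :* c₉ :+ con 0)))))))
      := c₉ :+ con 3 :* c₈ :+ con 12 :* c₇ :+ con 23 :* c₆ :+ con 33 :* c₅ :+ con 31 :* c₄
        :+ con 13 :* c₃ :+ c₂)
    refl (r C 2) (r C 3) (r C 4) (r C 5) (r C 6) (r C 7) (r C 8) (r C 9))
  where open ℕ-Solver

count₃ : ∀ r → length (starts r 4) ≡
  r C 12 ℕ.+ 4 ℕ.* (r C 11) ℕ.+ 19 ℕ.* (r C 10) ℕ.+ 49 ℕ.* (r C 9) ℕ.+ 105 ℕ.* (r C 8)
  ℕ.+ 163 ℕ.* (r C 7) ℕ.+ 177 ℕ.* (r C 6) ℕ.+ 131 ℕ.* (r C 5) ℕ.+ 53 ℕ.* (r C 4) ℕ.+ 7 ℕ.* (r C 3)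
count₃ r = trans (length-starts r 4)
  (solve 10 (λ c₃ c₄ c₅ c₆ c₇ c₈ c₉ c₁₀ c₁₁ c₁₂ →
      con 7 :* c₃ :+ (con 53 :* c₄ :+ (con 131 :* c₅ :+ (con 177 :* c₆ :+ (con 163 :* c₇
        :+ (con 105 :* c₈ :+ (con 49 :* c₉ :+ (con 19 :* c₁₀ :+ (con 4 :* c₁₁ :+ (con 1 :* c₁₂ :+ con 0)))))))))
      := c₁₂ :+ con 4 :* c₁₁ :+ con 19 :* c₁₀ :+ con 49 :* c₉ :+ con 105 :* c₈ :+ con 163 :* c₇
        :+ con 177 :* c₆ :+ con 131 :* c₅ :+ con 53 :* c₄ :+ con 7 :* c₃)
    refl (r C 3) (r C 4) (r C 5) (r C 6) (r C 7) (r C 8) (r C 9) (r C 10) (r C 11) (r C 12))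
  where open ℕ-Solver

-- Rational arithmetic and the embedding of the naturals

open +-*-Solver using (solve; _:=_; _:+_; _:*_; _:-_; :-_; con)

≤-resp : ∀ {p p′ q q′} → p ≡ p′ → q ≡ q′ → p ≤ q → p′ ≤ q′
≤-resp refl refl h = h

<-resp : ∀ {p p′ q q′} → p ≡ p′ → q ≡ q′ → p < q → p′ < q′
<-resp refl refl h = h

0<1 : 0ℚ < 1ℚ
0<1 = ℚP.positive⁻¹ 1ℚ

0≤-+ : ∀ {p q} → 0ℚ ≤ p → 0ℚ ≤ q → 0ℚ ≤ p + q
0≤-+ hp hq = ℚP.+-mono-≤ hp hq

0<-+ : ∀ {p q} → 0ℚ < p → 0ℚ ≤ q → 0ℚ < p + q
0<-+ hp hq = ℚP.+-mono-<-≤ hp hq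

0≤-* : ∀ {p q} → 0ℚ ≤ p → 0ℚ ≤ q → 0ℚ ≤ p * q
0≤-* {p} {q} hp hq = ℚP.nonNegative⁻¹ (p * q) {{ℚP.nonNeg*nonNeg⇒nonNeg p {{ℚ.nonNegative hp}} q {{ℚ.nonNegative hq}}}}

0<-* : ∀ {p q} → 0ℚ < p → 0ℚ < q → 0ℚ < p * q
0<-* {p} {q} hp hq = ℚP.positive⁻¹ (p * q) {{ℚP.pos*pos⇒pos p {{ℚ.positive hp}} q {{ℚ.positive hq}}}}

≤⇒0≤- : ∀ {p q} → p ≤ q → 0ℚ ≤ q - p
≤⇒0≤- {p} {q} h = ≤-resp (ℚP.+-inverseʳ p) refl (ℚP.+-monoˡ-≤ (- p) h)

0≤-⇒≤ : ∀ {p q} → 0ℚ ≤ q - p → p ≤ q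
0≤-⇒≤ {p} {q} h =
  ≤-resp (ℚP.+-identityˡ p) (solve 2 (λ p q → (q :- p) :+ p := q) refl p q) (ℚP.+-monoˡ-≤ p h)

<⇒0<- : ∀ {p q} → p < q → 0ℚ < q - p
<⇒0<- {p} {q} h = <-resp (ℚP.+-inverseʳ p) refl (ℚP.+-monoˡ-< (- p) h)

0<-⇒< : ∀ {p q} → 0ℚ < q - p → p < q
0<-⇒< {p} {q} h =
  <-resp (ℚP.+-identityˡ p) (solve 2 (λ p q → (q :- p) :+ p := q) refl p q) (ℚP.+-monoˡ-< p h)

-≡0⇒≡ : ∀ {p q} → p - q ≡ 0ℚ → p ≡ q
-≡0⇒≡ {p} {q} h = trans (solve 2 (λ p q → p := (p :- q) :+ q) refl p q)
                         (trans (cong (_+ q) h) (ℚP.+-identityˡ q))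

≡⇒-≡0 : ∀ {p q} → p ≡ q → p - q ≡ 0ℚ
≡⇒-≡0 {p} refl = ℚP.+-inverseʳ p

0<⇒≢0 : ∀ {p} → 0ℚ < p → p ≢ 0ℚ
0<⇒≢0 h e = <-irrefl (sym e) h

0≤∧≢0⇒0< : ∀ {p} → 0ℚ ≤ p → p ≢ 0ℚ → 0ℚ < p
0≤∧≢0⇒0< {p} h ne with 0ℚ ℚP.<? p
... | yes q = q
... | no q = ⊥-elim (ne (ℚP.≤-antisym (ℚP.≮⇒≥ q) h))

0≤⇒≡0⊎0< : ∀ {p} → 0ℚ ≤ p → p ≡ 0ℚ ⊎ 0ℚ < p
0≤⇒≡0⊎0< {p} h with p ℚP.≟ 0ℚ
... | yes e = inj₁ e
... | no ne = inj₂ (0≤∧≢0⇒0< h ne)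

sum≡0ˡ : ∀ {p q} → 0ℚ ≤ p → 0ℚ ≤ q → p + q ≡ 0ℚ → p ≡ 0ℚ
sum≡0ˡ {p} {q} hp hq e =
  ℚP.≤-antisym (≤-resp (ℚP.+-identityʳ p) e (ℚP.+-monoʳ-≤ p hq)) hp

sum≡0ʳ : ∀ {p q} → 0ℚ ≤ p → 0ℚ ≤ q → p + q ≡ 0ℚ → q ≡ 0ℚ
sum≡0ʳ {p} {q} hp hq e = sum≡0ˡ hq hp (trans (ℚP.+-comm q p) e)

inverse : ∀ {p} → p ≢ 0ℚ → Σ ℚ λ q → q * p ≡ 1ℚ
inverse {p} ne = (ℚ.1/ p) {{nz}} , ℚP.*-inverseˡ p {{nz}}
  where nz = ℚ.≢-nonZero ne

inverse-pos : ∀ {p} → 0ℚ < p → Σ ℚ λ q → 0ℚ < q × q * p ≡ 1ℚ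
inverse-pos {p} h = (ℚ.1/ p) {{nz}} , ℚP.positive⁻¹ _ {{ℚP.1/pos⇒pos p {{ℚ.positive h}}}} , ℚP.*-inverseˡ p {{nz}}
  where nz = ℚP.pos⇒nonZero p {{ℚ.positive h}}

*≡0⇒≡0 : ∀ {p q} → q ≢ 0ℚ → p * q ≡ 0ℚ → p ≡ 0ℚ
*≡0⇒≡0 {p} {q} ne e with inverse ne
... | i , iq = begin
  p             ≡⟨ ℚP.*-identityʳ p ⟨
  p * 1ℚ        ≡⟨ cong (p *_) iq ⟨
  p * (i * q)   ≡⟨ solve 3 (λ p i q → p :* (i :* q) := i :* (p :* q)) refl p i q ⟩
  i * (p * q)   ≡⟨ cong (i *_) e ⟩
  i * 0ℚ        ≡⟨ ℚP.*-zeroʳ i ⟩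
  0ℚ            ∎
  where open ≡-Reasoning

private
  -- `toℚ` passes through a gcd normalisation that is stuck for a variable `n`; in this form sums,
  -- products and comparisons compute.
  toℚ≡mkℚ : ∀ n → toℚ n ≡ mkℚ (ℤ.+ n) 0 (Coprime.sym (Coprime.1-coprimeTo n))
  toℚ≡mkℚ n = ℚP.normalize-coprime (Coprime.sym (Coprime.1-coprimeTo n))

toℚ-+ : ∀ m n → toℚ (m ℕ.+ n) ≡ toℚ m + toℚ n
toℚ-+ m n rewrite toℚ≡mkℚ m | toℚ≡mkℚ n =
  cong (ℚ._/ 1) (cong₂ ℤ._+_ (sym (ℤP.*-identityʳ (ℤ.+ m))) (sym (ℤP.*-identityʳ (ℤ.+ n))))

toℚ-* : ∀ m n → toℚ (m ℕ.* n) ≡ toℚ m * toℚ n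
toℚ-* m n rewrite toℚ≡mkℚ m | toℚ≡mkℚ n = cong (ℚ._/ 1) (ℤP.pos-* m n)

toℚ-mono : ∀ {m n} → m ℕ.≤ n → toℚ m ≤ toℚ n
toℚ-mono {m} {n} h rewrite toℚ≡mkℚ m | toℚ≡mkℚ n = ℚ.*≤* (ℤP.*-monoʳ-≤-nonNeg (ℤ.+ 1) (ℤ.+≤+ h))

toℚ-cancel : ∀ {m n} → toℚ m ≤ toℚ n → m ℕ.≤ n
toℚ-cancel {m} {n} h rewrite toℚ≡mkℚ m | toℚ≡mkℚ n with h
... | ℚ.*≤* p = ℤP.drop‿+≤+ (ℤP.*-cancelʳ-≤-pos (ℤ.+ m) (ℤ.+ n) (ℤ.+ 1) p)

toℚ-injective : ∀ {m n} → toℚ m ≡ toℚ n → m ≡ n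
toℚ-injective e = ℕP.≤-antisym (toℚ-cancel (ℚP.≤-reflexive e)) (toℚ-cancel (ℚP.≤-reflexive (sym e)))

0≤toℚ : ∀ n → 0ℚ ≤ toℚ n
0≤toℚ n = toℚ-mono {0} {n} ℕ.z≤n

0<toℚ-suc : ∀ n → 0ℚ < toℚ (suc n)
0<toℚ-suc n = ℚP.<-≤-trans 0<1 (toℚ-mono {1} {suc n} (ℕ.s≤s ℕ.z≤n))

clear-denominator : ∀ {q} → 0ℚ ≤ q → Σ ℕ λ N → Σ ℕ λ k → toℚ (suc N) * q ≡ toℚ k
clear-denominator {mkℚ (ℤ.+ k) N c} h = N , k , (begin
  toℚ (suc N) * q        ≡⟨ cong (_* q) (toℚ≡mkℚ (suc N)) ⟩
  (ℤ.+ suc N ℤ.* ℤ.+ k) ℚ./ (suc (N ℕ.+ 0)) ≡⟨ ℚP./-cong {p₁ = ℤ.+ suc N ℤ.* ℤ.+ k} refl (cong suc (ℕP.+-identityʳ N)) ⟩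
  (ℤ.+ suc N ℤ.* ℤ.+ k) ℚ./ (suc N) ≡⟨ ℚP.fromℚᵘ-cong {ℚᵘ.mkℚᵘ (ℤ.+ suc N ℤ.* ℤ.+ k) N} {ℚᵘ.mkℚᵘ (ℤ.+ k) 0} (ℚᵘ.*≡* (trans (ℤP.*-identityʳ _) (ℤP.*-comm (ℤ.+ suc N) (ℤ.+ k)))) ⟩
  toℚ k ∎)
  where
  open ≡-Reasoning
  q = mkℚ (ℤ.+ k) N c
clear-denominator {mkℚ (ℤ.-[1+ k ]) N c} (ℚ.*≤* ())

-- Finite sums and linear dependence

sumℚ-cong : ∀ {n} {f g : Fin n → ℚ} → (∀ i → f i ≡ g i) → sumℚ f ≡ sumℚ g
sumℚ-cong {zero} h = refl
sumℚ-cong {suc n} h = cong₂ _+_ (h zero) (sumℚ-cong (h ∘ suc))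

sumℚ-zero : ∀ {n} {f : Fin n → ℚ} → (∀ i → f i ≡ 0ℚ) → sumℚ f ≡ 0ℚ
sumℚ-zero {zero} h = refl
sumℚ-zero {suc n} h = cong₂ _+_ (h zero) (sumℚ-zero (h ∘ suc))

sumℚ-+ : ∀ {n} (f g : Fin n → ℚ) → sumℚ (λ i → f i + g i) ≡ sumℚ f + sumℚ g
sumℚ-+ {zero} f g = refl
sumℚ-+ {suc n} f g = trans (cong (f zero + g zero +_) (sumℚ-+ (f ∘ suc) (g ∘ suc)))
  (solve 4 (λ a b c d → (a :+ b) :+ (c :+ d) := (a :+ c) :+ (b :+ d)) refl
    (f zero) (g zero) (sumℚ (f ∘ suc)) (sumℚ (g ∘ suc)))

sumℚ-*ˡ : ∀ {n} c (f : Fin n → ℚ) → sumℚ (λ i → c * f i) ≡ c * sumℚ f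
sumℚ-*ˡ {zero} c f = sym (ℚP.*-zeroʳ c)
sumℚ-*ˡ {suc n} c f = trans (cong (c * f zero +_) (sumℚ-*ˡ c (f ∘ suc)))
  (sym (ℚP.*-distribˡ-+ c (f zero) (sumℚ (f ∘ suc))))

sumℚ-swap : ∀ {m n} (f : Fin m → Fin n → ℚ) →
  sumℚ (λ i → sumℚ (f i)) ≡ sumℚ (λ j → sumℚ (λ i → f i j))
sumℚ-swap {zero} {n} f = sym (sumℚ-zero {n} (λ _ → refl))
sumℚ-swap {suc m} f = trans (cong (sumℚ (f zero) +_) (sumℚ-swap (f ∘ suc)))
  (sym (sumℚ-+ (f zero) (λ j → sumℚ (λ i → f (suc i) j))))

sumℚ-nonneg : ∀ {n} {f : Fin n → ℚ} → (∀ i → 0ℚ ≤ f i) → 0ℚ ≤ sumℚ f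
sumℚ-nonneg {zero} h = ≤-refl
sumℚ-nonneg {suc n} h = 0≤-+ (h zero) (sumℚ-nonneg (h ∘ suc))

sumℚ-nonneg-≡0 : ∀ {n} {f : Fin n → ℚ} → (∀ i → 0ℚ ≤ f i) → sumℚ f ≡ 0ℚ → ∀ i → f i ≡ 0ℚ
sumℚ-nonneg-≡0 {suc n} h e zero = sum≡0ˡ (h zero) (sumℚ-nonneg (h ∘ suc)) e
sumℚ-nonneg-≡0 {suc n} h e (suc i) = sumℚ-nonneg-≡0 (h ∘ suc) (sum≡0ʳ (h zero) (sumℚ-nonneg (h ∘ suc)) e) i

-- The last component encodes that `R` is a rearrangement of `ρ ∷ R′`, in the only form needed: what
-- holds for `ρ` and on `R′` holds on `R`.
find-pivot : ∀ {k} (R : List (Fin (suc k) → ℚ)) →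
  All (λ ρ → ρ zero ≡ 0ℚ) R ⊎
  (Σ (Fin (suc k) → ℚ) λ ρ → Σ (List (Fin (suc k) → ℚ)) λ R′ →
    ρ zero ≢ 0ℚ × length R ≡ suc (length R′) ×
    (∀ (Q : (Fin (suc k) → ℚ) → Set) → Q ρ → All Q R′ → All Q R))
find-pivot [] = inj₁ []
find-pivot (σ ∷ R) with σ zero ℚP.≟ 0ℚ
... | no ne = inj₂ (σ , R , ne , refl , λ Q → _∷_)
... | yes e with find-pivot R
...   | inj₁ h = inj₁ (e ∷ h)
...   | inj₂ (ρ , R′ , ne , len , put) =
  inj₂ (ρ , σ ∷ R′ , ne , cong suc len , λ { Q q (q′ ∷ h) → q′ ∷ put Q q h })

-- Gaussian elimination: a homogeneous system with fewer equations than unknowns has a nonzero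
-- solution. Without a pivot in the first column the first unit vector solves it; otherwise one
-- unknown and one equation are eliminated.
dependent : ∀ {k} (R : List (Fin k → ℚ)) → length R ℕ.< k →
  Σ (Fin k → ℚ) λ α → (Σ (Fin k) λ j → α j ≢ 0ℚ) ×
    All (λ ρ → sumℚ (λ j → α j * ρ j) ≡ 0ℚ) R
dependent {suc k} R h with find-pivot R
... | inj₁ z = e₀ , (zero , ℚP.1≢0) , All.map (λ {ρ} → kills {ρ}) z
  where
  e₀ : Fin (suc k) → ℚ
  e₀ zero = 1ℚ
  e₀ (suc _) = 0ℚ
  kills : ∀ {ρ} → ρ zero ≡ 0ℚ → sumℚ (λ j → e₀ j * ρ j) ≡ 0ℚ
  kills {ρ} e = cong₂ _+_ (trans (ℚP.*-identityˡ _) e) (sumℚ-zero (λ j → ℚP.*-zeroˡ (ρ (suc j))))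
... | inj₂ (ρ , R′ , ne , len , put) with inverse ne
...   | ι , ιρ = α , (suc (proj₁ (proj₁ (proj₂ sub))) , proj₂ (proj₁ (proj₂ sub)))
               , put _ α-ρ (All.map (λ {σ} → α-σ {σ}) (AllP.map⁻ (proj₂ (proj₂ sub))))
  where
  open ≡-Reasoning
  reduce : (Fin (suc k) → ℚ) → Fin k → ℚ
  reduce σ j = σ (suc j) - σ zero * ι * ρ (suc j)
  sub = dependent (map reduce R′)
    (subst (ℕ._< k) (sym (length-map reduce R′)) (ℕP.≤-pred (subst (ℕ._< suc k) len h)))
  β = proj₁ sub
  α : Fin (suc k) → ℚ
  -- The value that the pivot row forces on the eliminated unknown.
  α zero = - (ι * sumℚ (λ j → β j * ρ (suc j)))
  α (suc j) = β j
  α-ρ : sumℚ (λ j → α j * ρ j) ≡ 0ℚ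
  α-ρ = begin
    - (ι * S) * ρ zero + S ≡⟨ solve 3 (λ ι S r → (:- (ι :* S)) :* r :+ S := S :- (ι :* r) :* S) refl ι S (ρ zero) ⟩
    S - (ι * ρ zero) * S   ≡⟨ cong (λ z → S - z * S) ιρ ⟩
    S - 1ℚ * S             ≡⟨ ≡⇒-≡0 (sym (ℚP.*-identityˡ S)) ⟩
    0ℚ                     ∎
    where S = sumℚ (λ j → β j * ρ (suc j))
  α-σ : ∀ {σ} → sumℚ (λ j → β j * reduce σ j) ≡ 0ℚ → sumℚ (λ j → α j * σ j) ≡ 0ℚ
  α-σ {σ} e = begin
    - (ι * S) * σ zero + sumℚ (λ j → β j * σ (suc j))
      ≡⟨ solve 4 (λ ι S s T → (:- (ι :* S)) :* s :+ T := T :+ (:- (s :* ι)) :* S) refl ι S (σ zero) T ⟩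
    T + (- (σ zero * ι)) * S
      ≡⟨ cong (T +_) (sumℚ-*ˡ (- (σ zero * ι)) (λ j → β j * ρ (suc j))) ⟨
    T + sumℚ (λ j → (- (σ zero * ι)) * (β j * ρ (suc j)))
      ≡⟨ sumℚ-+ (λ j → β j * σ (suc j)) (λ j → (- (σ zero * ι)) * (β j * ρ (suc j))) ⟨
    sumℚ (λ j → β j * σ (suc j) + (- (σ zero * ι)) * (β j * ρ (suc j)))
      ≡⟨ sumℚ-cong (λ j → solve 4 (λ b s c r → b :* s :+ (:- c) :* (b :* r) := b :* (s :- c :* r)) refl
           (β j) (σ (suc j)) (σ zero * ι) (ρ (suc j))) ⟩
    sumℚ (λ j → β j * reduce σ j) ≡⟨ e ⟩
    0ℚ ∎
    where
    S = sumℚ (λ j → β j * ρ (suc j))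
    T = sumℚ (λ j → β j * σ (suc j))

-- Profiles and the second-difference equation

-- A pair (λ, μ) of sequences together with the partial sums D of λ − μ,
-- possibly started from a nonzero value.
record Profile : Set where
  field
    l m D : ℕ → ℚ
    step  : ∀ k → D (suc k) ≡ D k + (l k - m k)
open Profile

tail : Profile → Profile
tail p = record { l = l p ∘ suc ; m = m p ∘ suc ; D = D p ∘ suc ; step = step p ∘ suc }

val : Profile → Kind → ℕ → ℚ
val p A k = l p k - l p (suc k)
val p B k = m p k - m p (suc k)
val p Δ k = D p (suc k)

second-difference : ∀ p → D p 2 ≡ (D p 1 + D p 1 - D p 0) + (val p B 0 - val p A 0)
second-difference p = begin
  D p 2 ≡⟨ step p 1 ⟩
  d₁ + (l₁ - m₁) ≡⟨ ℚP.+-identityʳ _ ⟨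
  (d₁ + (l₁ - m₁)) + 0ℚ ≡⟨ cong ((d₁ + (l₁ - m₁)) +_) (≡⇒-≡0 (step p 0)) ⟨
  (d₁ + (l₁ - m₁)) + (d₁ - (d₀ + (l₀ - m₀)))
    ≡⟨ solve 6 (λ d₀ d₁ l₀ l₁ m₀ m₁ → (d₁ :+ (l₁ :- m₁)) :+ (d₁ :- (d₀ :+ (l₀ :- m₀)))
         := (d₁ :+ d₁ :- d₀) :+ ((m₀ :- m₁) :- (l₀ :- l₁))) refl d₀ d₁ l₀ l₁ m₀ m₁ ⟩
  (d₁ + d₁ - d₀) + ((m₀ - m₁) - (l₀ - l₁)) ∎
  where
  open ≡-Reasoning
  d₀ = D p 0
  d₁ = D p 1
  l₀ = l p 0
  l₁ = l p 1
  m₀ = m p 0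
  m₁ = m p 1

Is : Bool → ℚ → Set
Is true q = 0ℚ < q
Is false q = q ≡ 0ℚ

Is-resp : ∀ b {p q} → p ≡ q → Is b p → Is b q
Is-resp b refl h = h

sign : ∀ {q} → 0ℚ ≤ q → Σ Bool λ b → Is b q
sign h with 0≤⇒≡0⊎0< h
... | inj₁ e = false , e
... | inj₂ p = true , p

Matches : ∀ {s n} → Word s n → Profile → Set
Matches w p = ∀ t k → Is (flags w t k) (val p t k)

matches-∷ : ∀ {s n} {ℓ : Letter s} {w : Word (target ℓ) n} {p} →
  Is (flag ℓ A) (val p A 0) → Is (flag ℓ B) (val p B 0) → Is (flag ℓ Δ) (D p 1) →
  Matches w (tail p) → Matches (ℓ ∷ w) p
matches-∷ a b d h A zero = a
matches-∷ a b d h B zero = b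
matches-∷ a b d h Δ zero = d
matches-∷ a b d h A (suc k) = h A k
matches-∷ a b d h B (suc k) = h B k
matches-∷ a b d h Δ (suc k) = h Δ k

-- `D p n` is listed separately because `val p Δ k` is `D` at `suc k`, so the indices from `n` on
-- miss it.
Vanishes-from : ℕ → Profile → Set
Vanishes-from n p = D p n ≡ 0ℚ × (∀ t k → n ℕ.≤ k → val p t k ≡ 0ℚ)

Nonneg : Profile → Set
Nonneg p = ∀ t k → 0ℚ ≤ val p t k

nonneg-tail : ∀ {p} → Nonneg p → Nonneg (tail p)
nonneg-tail h A k = h A (suc k)
nonneg-tail h B k = h B (suc k)
nonneg-tail h Δ k = h Δ (suc k)

vanishes-tail : ∀ {n p} → Vanishes-from (suc n) p → Vanishes-from n (tail p)
vanishes-tail {n} {p} (e , h) = e , go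
  where
  go : ∀ t k → n ℕ.≤ k → val (tail p) t k ≡ 0ℚ
  go A k le = h A (suc k) (ℕ.s≤s le)
  go B k le = h B (suc k) (ℕ.s≤s le)
  go Δ k le = h Δ (suc k) (ℕ.s≤s le)

-- From a profile to its word

at-zero : ∀ {d₀ d₁ d₂ a b} → d₀ ≡ 0ℚ → d₁ ≡ 0ℚ → d₂ ≡ (d₁ + d₁ - d₀) + (b - a) → b ≡ a + d₂
at-zero {a = a} {b} refl refl refl =
  solve 2 (λ a b → b := a :+ (con 0ℚ :+ (b :- a))) refl a b

private
  at-zero′ : ∀ {d₀ d₁ d₂ a b} → d₁ ≡ 0ℚ → d₂ ≡ (d₁ + d₁ - d₀) + (b - a) → b ≡ (d₀ + a) + d₂
  at-zero′ {d₀} {a = a} {b} refl refl =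
    solve 3 (λ d₀ a b → b := (d₀ :+ a) :+ ((con 0ℚ :- d₀) :+ (b :- a))) refl d₀ a b

  +-identityʳ′ : ∀ {p q r} → q ≡ 0ℚ → p ≡ r + q → p ≡ r
  +-identityʳ′ {r = r} refl h = trans h (ℚP.+-identityʳ r)

-- The hypotheses on `D p 0` and `D p 1` are the meaning of the states. `In₀` records a strict rise,
-- which persists while a = 0 because the slope then grows by b ≥ 0; as D must return to 0, a peak
-- has to come. Behind it, `In₁` records only positivity.
classify-Out : ∀ n p → Nonneg p → Vanishes-from n p → D p 0 ≡ 0ℚ → D p 1 ≡ 0ℚ →
  Σ (Word Out n) λ w → Matches w p
classify-In₀ : ∀ n p → Nonneg p → Vanishes-from n p → 0ℚ ≤ D p 0 → D p 0 < D p 1 →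
  Σ (Word In₀ n) λ w → Matches w p
classify-In₁ : ∀ n p → Nonneg p → Vanishes-from n p → 0ℚ < D p 0 → 0ℚ ≤ D p 1 →
  Σ (Word In₁ n) λ w → Matches w p

private
  prepend : ∀ {s n} p (ℓ : Letter s) →
    Is (flag ℓ A) (val p A 0) → Is (flag ℓ B) (val p B 0) → Is (flag ℓ Δ) (D p 1) →
    Σ (Word (target ℓ) n) (λ w → Matches w (tail p)) → Σ (Word s (suc n)) (λ w → Matches w p)
  prepend p ℓ a b d (w , h) = ℓ ∷ w , matches-∷ {p = p} a b d h

classify-Out zero p nn (_ , v) e₀ e₁ = [] , λ t k → v t k ℕ.z≤n
classify-Out (suc n) p nn v e₀ e₁ = go (sign (nn A 0)) (0≤⇒≡0⊎0< (nn Δ 1))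
  where
  b≡ : val p B 0 ≡ val p A 0 + D p 2
  b≡ = at-zero {D p 0} {D p 1} {D p 2} {val p A 0} {val p B 0} e₀ e₁ (second-difference p)
  go : (Σ Bool λ x → Is x (val p A 0)) → D p 2 ≡ 0ℚ ⊎ 0ℚ < D p 2 → Σ (Word Out (suc n)) λ w → Matches w p
  go (x , hx) (inj₁ e₂) = prepend p (idle x) hx (Is-resp x (sym (+-identityʳ′ {q = D p 2} e₂ b≡)) hx) e₁
    (classify-Out n (tail p) (nonneg-tail {p} nn) (vanishes-tail {p = p} v) e₁ e₂)
  go (x , hx) (inj₂ lt) = prepend p (open′ x) hx
    (<-resp refl (trans (ℚP.+-comm (D p 2) (val p A 0)) (sym b≡)) (0<-+ {D p 2} {val p A 0} lt (nn A 0))) e₁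
    (classify-In₀ n (tail p) (nonneg-tail {p} nn) (vanishes-tail {p = p} v) (nn Δ 0) (<-resp (sym e₁) refl lt))

-- At the end both `D p 0` and `D p 1` are 0, so D cannot still be rising.
classify-In₀ zero p nn (e , v) le lt = ⊥-elim (<-irrefl refl (<-resp e (v Δ 0 ℕ.z≤n) lt))
classify-In₀ (suc n) p nn v le lt = go (sign (nn A 0)) (sign (nn B 0))
  where
  rising : val p A 0 ≡ 0ℚ → D p 1 < D p 2
  rising e = 0<-⇒< {D p 1} {D p 2} (<-resp refl (begin
    (D p 1 - D p 0) + val p B 0
      ≡⟨ solve 3 (λ d₀ d₁ b → (d₁ :- d₀) :+ b := (d₁ :+ d₁ :- d₀) :+ (b :- con 0ℚ) :- d₁) refl
           (D p 0) (D p 1) (val p B 0) ⟩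
    (D p 1 + D p 1 - D p 0) + (val p B 0 - 0ℚ) - D p 1
      ≡⟨ cong (λ a → (D p 1 + D p 1 - D p 0) + (val p B 0 - a) - D p 1) e ⟨
    (D p 1 + D p 1 - D p 0) + (val p B 0 - val p A 0) - D p 1
      ≡⟨ cong (_- D p 1) (second-difference p) ⟨
    D p 2 - D p 1 ∎) (0<-+ {D p 1 - D p 0} {val p B 0} (<⇒0<- lt) (nn B 0)))
    where open ≡-Reasoning
  go : (Σ Bool λ x → Is x (val p A 0)) → (Σ Bool λ x → Is x (val p B 0)) → Σ (Word In₀ (suc n)) λ w → Matches w p
  go (true , hx) (y , hy) = prepend p (peak y) hx hy (ℚP.≤-<-trans le lt)
    (classify-In₁ n (tail p) (nonneg-tail {p} nn) (vanishes-tail {p = p} v) (ℚP.≤-<-trans le lt) (nn Δ 1))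
  go (false , hx) (y , hy) = prepend p (rise y) hx hy (ℚP.≤-<-trans le lt)
    (classify-In₀ n (tail p) (nonneg-tail {p} nn) (vanishes-tail {p = p} v) (nn Δ 0) (rising hx))

classify-In₁ zero p nn (e , v) lt le = ⊥-elim (<-irrefl refl (<-resp refl e lt))
classify-In₁ (suc n) p nn v lt le = go (sign (nn A 0)) (sign (nn B 0)) (0≤⇒≡0⊎0< le) (0≤⇒≡0⊎0< (nn Δ 1))
  where
  positive-b : D p 1 ≡ 0ℚ → 0ℚ < val p B 0
  positive-b e₁ = <-resp refl
    (sym (at-zero′ {D p 0} {D p 1} {D p 2} {val p A 0} {val p B 0} e₁ (second-difference p)))
    (0<-+ {D p 0 + val p A 0} {D p 2} (0<-+ {D p 0} {val p A 0} lt (nn A 0)) (nn Δ 1))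
  go : (Σ Bool λ x → Is x (val p A 0)) → (Σ Bool λ x → Is x (val p B 0)) →
    D p 1 ≡ 0ℚ ⊎ 0ℚ < D p 1 → D p 2 ≡ 0ℚ ⊎ 0ℚ < D p 2 → Σ (Word In₁ (suc n)) λ w → Matches w p
  go (x , hx) (y , hy) (inj₂ pos) _ = prepend p (inside x y) hx hy pos
    (classify-In₁ n (tail p) (nonneg-tail {p} nn) (vanishes-tail {p = p} v) pos (nn Δ 1))
  go (x , hx) _ (inj₁ e₁) (inj₁ e₂) = prepend p (close x) hx (positive-b e₁) e₁
    (classify-Out n (tail p) (nonneg-tail {p} nn) (vanishes-tail {p = p} v) e₁ e₂)
  go (x , hx) _ (inj₁ e₁) (inj₂ pos) = prepend p (reopen x) hx (positive-b e₁) e₁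
    (classify-In₀ n (tail p) (nonneg-tail {p} nn) (vanishes-tail {p = p} v) (nn Δ 0) (<-resp (sym e₁) refl pos))

classify : ∀ n p → Nonneg p → Vanishes-from n p → D p 0 ≡ 0ℚ →
  Σ State λ s → Initial s × (Σ (Word s n) λ w → Matches w p)
classify n p nn v e₀ = go (0≤⇒≡0⊎0< (nn Δ 0))
  where
  go : D p 1 ≡ 0ℚ ⊎ 0ℚ < D p 1 → Σ State λ s → Initial s × (Σ (Word s n) λ w → Matches w p)
  go (inj₁ e₁) = Out , out , classify-Out n p nn v e₀ e₁
  go (inj₂ lt) = In₀ , in₀ , classify-In₀ n p nn v (ℚP.≤-reflexive (sym e₀)) (<-resp (sym e₀) refl lt)

-- From a word to a profile

Finite : ℕ → Profile → Set
Finite n p = ∀ k → n ℕ.≤ k → l p k ≡ 0ℚ × m p k ≡ 0ℚ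

-- Profiles are built from the right: `a` and `b` become the first differences, and the new initial
-- D is the one that the second-difference equation forces.
extend : ℚ → ℚ → Profile → Profile
extend a b p = record { l = l′ ; m = m′ ; D = D′ ; step = step′ }
  where
  l′ m′ D′ : ℕ → ℚ
  l′ zero = a + l p 0
  l′ (suc k) = l p k
  m′ zero = b + m p 0
  m′ (suc k) = m p k
  D′ zero = (D p 0 + D p 0 - D p 1) + (b - a)
  D′ (suc k) = D p k
  step′ : ∀ k → D′ (suc k) ≡ D′ k + (l′ k - m′ k)
  step′ zero = sym (begin
    ((d₀ + d₀ - d₁) + (b - a)) + ((a + l₀) - (b + m₀))
      ≡⟨ solve 6 (λ a b d₀ d₁ l₀ m₀ → ((d₀ :+ d₀ :- d₁) :+ (b :- a)) :+ ((a :+ l₀) :- (b :+ m₀))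
           := d₀ :- (d₁ :- (d₀ :+ (l₀ :- m₀)))) refl a b d₀ d₁ l₀ m₀ ⟩
    d₀ - (d₁ - (d₀ + (l₀ - m₀))) ≡⟨ cong (λ z → d₀ - z) (≡⇒-≡0 (step p 0)) ⟩
    d₀ - 0ℚ ≡⟨ ℚP.+-identityʳ d₀ ⟩
    d₀ ∎)
    where
    open ≡-Reasoning
    d₀ = D p 0
    d₁ = D p 1
    l₀ = l p 0
    m₀ = m p 0
  step′ (suc k) = step p k

scale : ℚ → Profile → Profile
scale t p = record { l = λ k → t * l p k ; m = λ k → t * m p k ; D = λ k → t * D p k
                   ; step = λ k → trans (cong (t *_) (step p k))
                       (solve 4 (λ t d x y → t :* (d :+ (x :- y)) := t :* d :+ (t :* x :- t :* y)) refl
                         t (D p k) (l p k) (m p k)) }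

val-scale : ∀ t p κ k → val (scale t p) κ k ≡ t * val p κ k
val-scale t p A k = solve 3 (λ t x y → t :* x :- t :* y := t :* (x :- y)) refl t (l p k) (l p (suc k))
val-scale t p B k = solve 3 (λ t x y → t :* x :- t :* y := t :* (x :- y)) refl t (m p k) (m p (suc k))
val-scale t p Δ k = refl

Is-scale : ∀ {t} → 0ℚ < t → ∀ b {q} → Is b q → Is b (t * q)
Is-scale h true = 0<-* h
Is-scale {t} h false refl = ℚP.*-zeroʳ t

matches-scale : ∀ {t} → 0ℚ < t → ∀ {s n} {w : Word s n} {p} → Matches w p → Matches w (scale t p)
matches-scale {t} h {w = w} {p} M κ k =
  Is-resp (flags w κ k) (sym (val-scale t p κ k)) (Is-scale h (flags w κ k) (M κ k))

finite-scale : ∀ {t n p} → Finite n p → Finite n (scale t p)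
finite-scale {t} f k le with f k le
... | e , e′ = trans (cong (t *_) e) (ℚP.*-zeroʳ t) , trans (cong (t *_) e′) (ℚP.*-zeroʳ t)

record Realisation {s n} (w : Word s n) : Set where
  constructor realised
  field
    profile : Profile
    matches : Matches w profile
    finite  : Finite n profile
open Realisation

bitℚ : Bool → ℚ
bitℚ true = 1ℚ
bitℚ false = 0ℚ

Is-bitℚ : ∀ b → Is b (bitℚ b)
Is-bitℚ true = 0<1
Is-bitℚ false = refl

0≤bitℚ : ∀ b → 0ℚ ≤ bitℚ b
0≤bitℚ true = <⇒≤ 0<1
0≤bitℚ false = ≤-refl

realise-∷ : ∀ {s n} {ℓ : Letter s} {w : Word (target ℓ) n} (R : Realisation w) a b →
  Is (flag ℓ A) a → Is (flag ℓ B) b → Is (flag ℓ Δ) (D (profile R) 0) → Realisation (ℓ ∷ w)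
realise-∷ {ℓ = ℓ} {w} (realised p M f) a b ha hb hd = realised (extend a b p)
  (matches-∷ (Is-resp (flag ℓ A) (cancel a (l p 0)) ha) (Is-resp (flag ℓ B) (cancel b (m p 0)) hb) hd tails)
  (λ { (suc k) (ℕ.s≤s le) → f k le })
  where
  cancel : ∀ x y → x ≡ (x + y) - y
  cancel = solve 2 (λ x y → x := (x :+ y) :- y) refl
  tails : Matches w (tail (extend a b p))
  tails A k = M A k
  tails B k = M B k
  tails Δ k = M Δ k

-- From In₀ any rising start (d, e) can be continued, because at the peak the rest
-- may be rescaled to fit; from In₁ the profile is built backwards from its end.
realise-Out : ∀ {n} (w : Word Out n) → Σ (Realisation w) λ R → D (profile R) 0 ≡ 0ℚ × D (profile R) 1 ≡ 0ℚ
realise-In₀ : ∀ {n} (w : Word In₀ n) d e → 0ℚ ≤ d → d < e →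
  Σ (Realisation w) λ R → D (profile R) 0 ≡ d × D (profile R) 1 ≡ e
realise-In₁ : ∀ {n} (w : Word In₁ n) →
  Σ (Realisation w) λ R → D (profile R) 1 < D (profile R) 0 × 0ℚ ≤ D (profile R) 1

realise-Out [] = realised (record { l = λ _ → 0ℚ ; m = λ _ → 0ℚ ; D = λ _ → 0ℚ ; step = λ _ → refl })
  (λ { A k → refl ; B k → refl ; Δ k → refl }) (λ _ _ → refl , refl) , refl , refl
realise-Out (idle x ∷ w) = go (realise-Out w)
  where
  value : ∀ {d₀ d₁} x → d₀ ≡ 0ℚ → d₁ ≡ 0ℚ → (d₀ + d₀ - d₁) + (x - x) ≡ 0ℚ
  value x refl refl = solve 1 (λ x → con 0ℚ :+ (x :- x) := con 0ℚ) refl x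
  go : (Σ (Realisation w) λ R → D (profile R) 0 ≡ 0ℚ × D (profile R) 1 ≡ 0ℚ) →
    Σ (Realisation (idle x ∷ w)) λ R → D (profile R) 0 ≡ 0ℚ × D (profile R) 1 ≡ 0ℚ
  go (R , e₀ , e₁) = realise-∷ R (bitℚ x) (bitℚ x) (Is-bitℚ x) (Is-bitℚ x) e₀ ,
    value (bitℚ x) e₀ e₁ , e₀
realise-Out (open′ x ∷ w) = go (realise-In₀ w 0ℚ 1ℚ ≤-refl 0<1)
  where
  value : ∀ {d₀ d₁} x → d₀ ≡ 0ℚ → d₁ ≡ 1ℚ → (d₀ + d₀ - d₁) + ((1ℚ + x) - x) ≡ 0ℚ
  value x refl refl = solve 1 (λ x → con (- 1ℚ) :+ ((con 1ℚ :+ x) :- x) := con 0ℚ) refl x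
  go : (Σ (Realisation w) λ R → D (profile R) 0 ≡ 0ℚ × D (profile R) 1 ≡ 1ℚ) →
    Σ (Realisation (open′ x ∷ w)) λ R → D (profile R) 0 ≡ 0ℚ × D (profile R) 1 ≡ 0ℚ
  go (R , e₀ , e₁) =
    -- b exceeds a by exactly the next D, which is 1; this makes the new D zero.
    realise-∷ R (bitℚ x) (1ℚ + bitℚ x) (Is-bitℚ x) (0<-+ {1ℚ} {bitℚ x} 0<1 (0≤bitℚ x)) e₀ ,
    value (bitℚ x) e₀ e₁ , e₀

realise-In₀ (rise y ∷ w) d e 0≤d d<e =
  -- The third value of D is forced by a = 0 and the chosen b; it exceeds `e` because the slope has
  -- not decreased.
  go (realise-In₀ w e (e + (e - d) + bitℚ y) (<⇒≤ 0<e) (0<-⇒< {e} {e + (e - d) + bitℚ y}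
    (<-resp refl (solve 3 (λ e d y → (e :- d) :+ y := e :+ (e :- d) :+ y :- e) refl e d (bitℚ y))
      (0<-+ {e - d} {bitℚ y} (<⇒0<- d<e) (0≤bitℚ y)))))
  where
  0<e : 0ℚ < e
  0<e = ℚP.≤-<-trans 0≤d d<e
  value : ∀ {d₀ d₁} y → d₀ ≡ e → d₁ ≡ e + (e - d) + y → (d₀ + d₀ - d₁) + (y - 0ℚ) ≡ d
  value y refl refl =
    solve 3 (λ e d y → (e :+ e :- (e :+ (e :- d) :+ y)) :+ (y :- con 0ℚ) := d) refl e d y
  go : (Σ (Realisation w) λ R → D (profile R) 0 ≡ e × D (profile R) 1 ≡ e + (e - d) + bitℚ y) →
    Σ (Realisation (rise y ∷ w)) λ R → D (profile R) 0 ≡ d × D (profile R) 1 ≡ e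
  go (R , e₀ , e₁) = realise-∷ R 0ℚ (bitℚ y) refl (Is-bitℚ y) (<-resp refl (sym e₀) 0<e) ,
    value (bitℚ y) e₀ e₁ , e₀
realise-In₀ (peak y ∷ w) d e 0≤d d<e = go (realise-In₁ w)
  where
  0<e : 0ℚ < e
  0<e = ℚP.≤-<-trans 0≤d d<e
  go : (Σ (Realisation w) λ R → D (profile R) 1 < D (profile R) 0 × 0ℚ ≤ D (profile R) 1) →
    Σ (Realisation (peak y ∷ w)) λ R → D (profile R) 0 ≡ d × D (profile R) 1 ≡ e
  go (realised p M f , lt , le) = found (inverse-pos (ℚP.≤-<-trans le lt))
    where
    found : (Σ ℚ λ q → 0ℚ < q × q * D p 0 ≡ 1ℚ) →
      Σ (Realisation (peak y ∷ w)) λ R → D (profile R) 0 ≡ d × D (profile R) 1 ≡ e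
    found (q , 0<q , qd) = realise-∷ R a (bitℚ y) 0<a (Is-bitℚ y) (<-resp refl (sym e₀) 0<e) ,
      value (t * D p 1) (bitℚ y) e₀ , e₀
      where
      t a : ℚ
      -- `q` inverts the initial D of the rest, so scaling by `t` makes the rest start at `e`.
      t = e * q
      0<t : 0ℚ < t
      0<t = 0<-* 0<e 0<q
      R : Realisation w
      R = realised (scale t p) (matches-scale 0<t {w = w} {p} M) (finite-scale {t} {p = p} f)
      e₀ : t * D p 0 ≡ e
      e₀ = trans (ℚP.*-assoc e q (D p 0)) (trans (cong (e *_) qd) (ℚP.*-identityʳ e))
      falling : t * D p 1 < e
      falling = <-resp refl e₀ (ℚP.*-monoʳ-<-pos t {{ℚ.positive 0<t}} lt)
      -- The a that the second-difference equation demands for D to run through d, e and the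
      -- rescaled next value; it is positive because D climbs to `e` and falls behind it.
      a = ((e - d) + (e - t * D p 1)) + bitℚ y
      0<a : 0ℚ < a
      0<a = 0<-+ {(e - d) + (e - t * D p 1)} {bitℚ y}
        (0<-+ {e - d} {e - t * D p 1} (<⇒0<- d<e) (<⇒≤ (<⇒0<- falling))) (0≤bitℚ y)
      value : ∀ {d₀} d₁ y → d₀ ≡ e → (d₀ + d₀ - d₁) + (y - (((e - d) + (e - d₁)) + y)) ≡ d
      value d₁ y refl =
        solve 4 (λ e d d₁ y → (e :+ e :- d₁) :+ (y :- (((e :- d) :+ (e :- d₁)) :+ y)) := d) refl e d d₁ y

realise-In₁ (inside x y ∷ w) = go (realise-In₁ w)
  where
  -- Half of the drop e − f leaves room for a positive entry.
  dent : Bool → ℚ → ℚ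
  dent true q = ½ * q
  dent false q = 0ℚ
  Is-dent : ∀ x {q} → 0ℚ < q → Is x (dent x q)
  Is-dent true h = 0<-* {½} (ℚP.positive⁻¹ ½) h
  Is-dent false h = refl
  dent< : ∀ x {q} → 0ℚ < q → 0ℚ < q - dent x q
  dent< true {q} h = <-resp refl (solve 1 (λ q → con ½ :* q := q :- con ½ :* q) refl q) (0<-* {½} (ℚP.positive⁻¹ ½) h)
  dent< false {q} h = <-resp refl (sym (ℚP.+-identityʳ q)) h
  go : (Σ (Realisation w) λ R → D (profile R) 1 < D (profile R) 0 × 0ℚ ≤ D (profile R) 1) →
    Σ (Realisation (inside x y ∷ w)) λ R → D (profile R) 1 < D (profile R) 0 × 0ℚ ≤ D (profile R) 1
  go (R , lt , le) = realise-∷ R a (bitℚ y) (Is-dent x drop) (Is-bitℚ y) 0<e ,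
    0<-⇒< {e} (<-resp refl
      (solve 4 (λ e f a y → ((e :- f) :- a) :+ y := (e :+ e :- f) :+ (y :- a) :- e) refl e f a (bitℚ y))
      (0<-+ {(e - f) - a} {bitℚ y} (dent< x drop) (0≤bitℚ y))) ,
    <⇒≤ 0<e
    where
    e f a : ℚ
    e = D (profile R) 0
    f = D (profile R) 1
    drop : 0ℚ < e - f
    drop = <⇒0<- lt
    0<e : 0ℚ < e
    0<e = ℚP.≤-<-trans le lt
    a = dent x (e - f)
realise-In₁ (close x ∷ w) = go (realise-Out w)
  where
  value : ∀ {d₀ d₁} x → d₀ ≡ 0ℚ → d₁ ≡ 0ℚ → 1ℚ ≡ (d₀ + d₀ - d₁) + ((1ℚ + x) - x)
  value x refl refl = solve 1 (λ x → con 1ℚ := con 0ℚ :+ ((con 1ℚ :+ x) :- x)) refl x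
  go : (Σ (Realisation w) λ R → D (profile R) 0 ≡ 0ℚ × D (profile R) 1 ≡ 0ℚ) →
    Σ (Realisation (close x ∷ w)) λ R → D (profile R) 1 < D (profile R) 0 × 0ℚ ≤ D (profile R) 1
  go (R , e₀ , e₁) =
    realise-∷ R (bitℚ x) (1ℚ + bitℚ x) (Is-bitℚ x) (0<-+ {1ℚ} {bitℚ x} 0<1 (0≤bitℚ x)) e₀ ,
    <-resp (sym e₀) (value (bitℚ x) e₀ e₁) 0<1 , ℚP.≤-reflexive (sym e₀)
realise-In₁ (reopen x ∷ w) = go (realise-In₀ w 0ℚ 1ℚ ≤-refl 0<1)
  where
  value : ∀ {d₀ d₁} x → d₀ ≡ 0ℚ → d₁ ≡ 1ℚ → 1ℚ ≡ (d₀ + d₀ - d₁) + (((1ℚ + 1ℚ) + x) - x)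
  value x refl refl = solve 1 (λ x → con 1ℚ := con (- 1ℚ) :+ ((con (1ℚ + 1ℚ) :+ x) :- x)) refl x
  go : (Σ (Realisation w) λ R → D (profile R) 0 ≡ 0ℚ × D (profile R) 1 ≡ 1ℚ) →
    Σ (Realisation (reopen x ∷ w)) λ R → D (profile R) 1 < D (profile R) 0 × 0ℚ ≤ D (profile R) 1
  go (R , e₀ , e₁) =
    -- Of the surplus 2 of b over a, one unit accounts for the rise to 1 behind this zero of D, the
    -- other for the value 1 in front of it.
    realise-∷ R (bitℚ x) ((1ℚ + 1ℚ) + bitℚ x) (Is-bitℚ x) (0<-+ {1ℚ + 1ℚ} {bitℚ x} (0<-+ 0<1 (<⇒≤ 0<1)) (0≤bitℚ x)) e₀ ,
    <-resp (sym e₀) (value (bitℚ x) e₀ e₁) 0<1 , ℚP.≤-reflexive (sym e₀)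

realise : ∀ {s n} → Initial s → (w : Word s n) → Σ (Realisation w) λ R → D (profile R) 0 ≡ 0ℚ
realise out w = proj₁ (realise-Out w) , proj₁ (proj₂ (realise-Out w))
realise in₀ w = proj₁ (realise-In₀ w 0ℚ 1ℚ ≤-refl 0<1) , proj₁ (proj₂ (realise-In₀ w 0ℚ 1ℚ ≤-refl 0<1))

-- The coordinates counted by the weight determine a point

coordinates : ∀ {s n} → Word s n → List (Kind × ℕ)
coordinates [] = []
coordinates (ℓ ∷ w) = (if flag ℓ A then (A , 0) ∷ [] else []) ++ (if flag ℓ B ∧ flag ℓ Δ then (B , 0) ∷ [] else [])
  ++ map (λ (t , k) → t , suc k) (coordinates w)

length-coordinates : ∀ {s n} (w : Word s n) → length (coordinates w) ≡ weight w
length-coordinates [] = refl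
length-coordinates (ℓ ∷ w) = begin
  length (as ++ bs ++ rest)                     ≡⟨ length-++ as ⟩
  length as ℕ.+ length (bs ++ rest)              ≡⟨ cong (length as ℕ.+_) (length-++ bs) ⟩
  length as ℕ.+ (length bs ℕ.+ length rest)      ≡⟨ ℕP.+-assoc (length as) (length bs) (length rest) ⟨
  length as ℕ.+ length bs ℕ.+ length rest
    ≡⟨ cong₂ ℕ._+_ (cong₂ ℕ._+_ (singleton (flag ℓ A)) (singleton (flag ℓ B ∧ flag ℓ Δ)))
         (trans (length-map _ (coordinates w)) (length-coordinates w)) ⟩
  weight (ℓ ∷ w) ∎
  where
  open ≡-Reasoning
  as bs rest : List (Kind × ℕ)
  as = if flag ℓ A then (A , 0) ∷ [] else []
  bs = if flag ℓ B ∧ flag ℓ Δ then (B , 0) ∷ [] else []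
  rest = map (λ (t , k) → t , suc k) (coordinates w)
  singleton : ∀ b {x : Kind × ℕ} → length (if b then x ∷ [] else []) ≡ bit b
  singleton true = refl
  singleton false = refl

Supported : ∀ {s n} → Word s n → Profile → Set
Supported w p = ∀ t k → flags w t k ≡ false → val p t k ≡ 0ℚ

Annihilated : ∀ {s n} → Word s n → Profile → Set
Annihilated w p = All (λ (t , k) → val p t k ≡ 0ℚ) (coordinates w)

supported-tail : ∀ {s n} {ℓ : Letter s} {w : Word (target ℓ) n} {p} → Supported (ℓ ∷ w) p → Supported w (tail p)
supported-tail h A k = h A (suc k)
supported-tail h B k = h B (suc k)
supported-tail h Δ k = h Δ (suc k)

annihilated-tail : ∀ {s n} {ℓ : Letter s} {w : Word (target ℓ) n} {p} → Annihilated (ℓ ∷ w) p → Annihilated w (tail p)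
annihilated-tail {ℓ = ℓ} {w} {p} h = All.map (λ { {A , k} e → e ; {B , k} e → e ; {Δ , k} e → e })
  (AllP.map⁻ (AllP.++⁻ʳ (if flag ℓ B ∧ flag ℓ Δ then (B , 0) ∷ [] else [])
    (AllP.++⁻ʳ (if flag ℓ A then (A , 0) ∷ [] else []) h)))

head-A : ∀ {s n} (ℓ : Letter s) (w : Word (target ℓ) n) {p} → Supported (ℓ ∷ w) p → Annihilated (ℓ ∷ w) p → val p A 0 ≡ 0ℚ
head-A ℓ w {p} sup ann = go (flag ℓ A) refl (AllP.++⁻ˡ (if flag ℓ A then (A , 0) ∷ [] else []) ann)
  where
  go : ∀ b → flag ℓ A ≡ b → All (λ (t , k) → val p t k ≡ 0ℚ) (if flag ℓ A then (A , 0) ∷ [] else []) →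
    val p A 0 ≡ 0ℚ
  go false e _ = sup A 0 e
  go true e h = All.head (subst (λ b → All (λ (t , k) → val p t k ≡ 0ℚ) (if b then (A , 0) ∷ [] else [])) e h)

head-B : ∀ {s n} (ℓ : Letter s) (w : Word (target ℓ) n) {p} → flag ℓ Δ ≡ true →
  Supported (ℓ ∷ w) p → Annihilated (ℓ ∷ w) p → val p B 0 ≡ 0ℚ
head-B ℓ w {p} d sup ann = go (flag ℓ B) refl
    (AllP.++⁻ˡ (if flag ℓ B ∧ flag ℓ Δ then (B , 0) ∷ [] else [])
      (AllP.++⁻ʳ (if flag ℓ A then (A , 0) ∷ [] else []) ann))
  where
  go : ∀ b → flag ℓ B ≡ b → All (λ (t , k) → val p t k ≡ 0ℚ) (if flag ℓ B ∧ flag ℓ Δ then (B , 0) ∷ [] else []) →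
    val p B 0 ≡ 0ℚ
  go false e _ = sup B 0 e
  go true e h = All.head
    (subst (λ b → All (λ (t , k) → val p t k ≡ 0ℚ) (if b then (B , 0) ∷ [] else [])) (cong₂ _∧_ e d) h)

private
  linear : ∀ {d₀ d₁ d₂ a b} → a ≡ 0ℚ → b ≡ 0ℚ → d₂ ≡ (d₁ + d₁ - d₀) + (b - a) → d₂ ≡ d₁ + (d₁ - d₀)
  linear {d₀} {d₁} refl refl e = trans e (solve 2 (λ d₀ d₁ → (d₁ :+ d₁ :- d₀) :+ con 0ℚ := d₁ :+ (d₁ :- d₀)) refl d₀ d₁)

  -- Along a block D is linear until it hits 0, here after κ further steps.
  Hits : Profile → Set
  Hits p = Σ ℕ λ κ → D p 1 + toℚ κ * (D p 1 - D p 0) ≡ 0ℚ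

  hits-step : ∀ {d₀ d₁ d₂} κ → d₂ ≡ d₁ + (d₁ - d₀) → d₂ + toℚ κ * (d₂ - d₁) ≡ 0ℚ →
    d₁ + toℚ (suc κ) * (d₁ - d₀) ≡ 0ℚ
  hits-step {d₀} {d₁} κ refl e = begin
    d₁ + toℚ (suc κ) * (d₁ - d₀) ≡⟨ cong (λ z → d₁ + z * (d₁ - d₀)) (toℚ-+ 1 κ) ⟩
    d₁ + (1ℚ + toℚ κ) * (d₁ - d₀)
      ≡⟨ solve 3 (λ d₀ d₁ κ → d₁ :+ (con 1ℚ :+ κ) :* (d₁ :- d₀)
           := (d₁ :+ (d₁ :- d₀)) :+ κ :* ((d₁ :+ (d₁ :- d₀)) :- d₁)) refl d₀ d₁ (toℚ κ) ⟩
    (d₁ + (d₁ - d₀)) + toℚ κ * ((d₁ + (d₁ - d₀)) - d₁) ≡⟨ e ⟩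
    0ℚ ∎
    where open ≡-Reasoning

  -- A linear sequence with zeros at step 0 and at step κ + 1 is zero: here (κ + 1) d₁ = 0.
  hits-zero : ∀ {d₀ d₁} κ → d₀ ≡ 0ℚ → d₁ + toℚ κ * (d₁ - d₀) ≡ 0ℚ → d₁ ≡ 0ℚ
  hits-zero {d₁ = d₁} κ refl e = *≡0⇒≡0 {d₁} {toℚ (suc κ)} (0<⇒≢0 (0<toℚ-suc κ)) (begin
    d₁ * toℚ (suc κ) ≡⟨ cong (d₁ *_) (toℚ-+ 1 κ) ⟩
    d₁ * (1ℚ + toℚ κ) ≡⟨ solve 2 (λ d₁ κ → d₁ :* (con 1ℚ :+ κ) := d₁ :+ κ :* (d₁ :- con 0ℚ)) refl d₁ (toℚ κ) ⟩
    d₁ + toℚ κ * (d₁ - 0ℚ) ≡⟨ e ⟩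
    0ℚ ∎)
    where open ≡-Reasoning

  inside? : ∀ {s} (ℓ : Letter s) → s ≢ Out → (flag ℓ Δ ≡ true × target ℓ ≢ Out) ⊎ flag ℓ Δ ≡ false
  inside? (idle _) ne = ⊥-elim (ne refl)
  inside? (open′ _) ne = ⊥-elim (ne refl)
  inside? (rise _) ne = inj₁ (refl , λ ())
  inside? (peak _) ne = inj₁ (refl , λ ())
  inside? (inside _ _) ne = inj₁ (refl , λ ())
  inside? (close _) ne = inj₂ refl
  inside? (reopen _) ne = inj₂ refl

  -- With a and b annihilated the slope of D is constant along the block, and the block does end,
  -- because the word has to return to `Out`.
  hits : ∀ {s n} (w : Word s n) → s ≢ Out → ∀ p → Supported w p → Annihilated w p → Hits p
  hits [] ne p sup ann = ⊥-elim (ne refl)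
  hits (ℓ ∷ w) ne p sup ann = go (inside? ℓ ne)
    where
    continue : flag ℓ Δ ≡ true → Hits (tail p) → Hits p
    continue d (κ , e) = suc κ , hits-step {D p 0} {D p 1} {D p 2} κ
      (linear {D p 0} {D p 1} {D p 2} (head-A ℓ w {p} sup ann) (head-B ℓ w {p} d sup ann) (second-difference p)) e
    go : (flag ℓ Δ ≡ true × target ℓ ≢ Out) ⊎ flag ℓ Δ ≡ false → Hits p
    go (inj₁ (d , ne′)) =
      continue d (hits w ne′ (tail p) (supported-tail {ℓ = ℓ} {w} {p} sup) (annihilated-tail {ℓ = ℓ} {w} {p} ann))
    go (inj₂ d) = 0 , trans (cong (_+ toℚ 0 * (D p 1 - D p 0)) (sup Δ 0 d))
      (solve 1 (λ x → con 0ℚ :+ con 0ℚ :* x := con 0ℚ) refl (D p 1 - D p 0))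

  boundary? : ∀ {s} (ℓ : Letter s) → flag ℓ Δ ≡ true ⊎ Initial (target ℓ)
  boundary? (idle _) = inj₂ out
  boundary? (open′ _) = inj₂ in₀
  boundary? (rise _) = inj₁ refl
  boundary? (peak _) = inj₁ refl
  boundary? (inside _ _) = inj₁ refl
  boundary? (close _) = inj₂ out
  boundary? (reopen _) = inj₂ in₀

starts-at-zero : ∀ {s n} → Initial s → (w : Word s n) → ∀ p → Supported w p → Annihilated w p →
  D p 0 ≡ 0ℚ → D p 1 ≡ 0ℚ
starts-at-zero out [] p sup ann e₀ = sup Δ 0 refl
starts-at-zero out (idle _ ∷ w) p sup ann e₀ = sup Δ 0 refl
starts-at-zero out (open′ _ ∷ w) p sup ann e₀ = sup Δ 0 refl
starts-at-zero in₀ w p sup ann e₀ = go (hits w (λ ()) p sup ann)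
  where
  go : Hits p → D p 1 ≡ 0ℚ
  go (κ , e) = hits-zero {D p 0} {D p 1} κ e₀ e

-- Two consecutive zeros of D propagate. With a = 0 and D zero twice, b equals the next D. On a
-- letter inside a block b is annihilated; at any other letter the rest begins at a zero of D, and
-- `starts-at-zero` applies.
vanishes : ∀ {s n} (w : Word s n) p → Supported w p → Annihilated w p → D p 0 ≡ 0ℚ → D p 1 ≡ 0ℚ →
  ∀ t k → val p t k ≡ 0ℚ
vanishes [] p sup ann e₀ e₁ t k = sup t k refl
vanishes (ℓ ∷ w) p sup ann e₀ e₁ = result
  where
  sup′ : Supported w (tail p)
  sup′ = supported-tail {ℓ = ℓ} {w} {p} sup
  ann′ : Annihilated w (tail p)
  ann′ = annihilated-tail {ℓ = ℓ} {w} {p} ann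
  a≡0 : val p A 0 ≡ 0ℚ
  a≡0 = head-A ℓ w {p} sup ann
  b≡ : val p B 0 ≡ val p A 0 + D p 2
  b≡ = at-zero {D p 0} {D p 1} {D p 2} {val p A 0} {val p B 0} e₀ e₁ (second-difference p)
  go : flag ℓ Δ ≡ true ⊎ Initial (target ℓ) → D p 2 ≡ 0ℚ
  go (inj₁ d) = trans (sym (ℚP.+-identityˡ (D p 2)))
    (trans (cong (_+ D p 2) (sym a≡0)) (trans (sym b≡) (head-B ℓ w {p} d sup ann)))
  go (inj₂ i) = starts-at-zero i w (tail p) sup′ ann′ e₁
  d₂≡0 : D p 2 ≡ 0ℚ
  d₂≡0 = go (boundary? ℓ)
  rec : ∀ t k → val (tail p) t k ≡ 0ℚ
  rec = vanishes w (tail p) sup′ ann′ e₁ d₂≡0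
  result : ∀ t k → val p t k ≡ 0ℚ
  result A zero = a≡0
  result B zero = trans b≡ (trans (cong₂ _+_ a≡0 d₂≡0) refl)
  result Δ zero = e₁
  result A (suc k) = rec A k
  result B (suc k) = rec B k
  result Δ (suc k) = rec Δ k

-- No sign condition is imposed on `p`, so this applies to arbitrary linear combinations of points
-- of a face and bounds its dimension from above.
determined : ∀ {s n} → Initial s → (w : Word s n) → ∀ p → Supported w p → Annihilated w p → D p 0 ≡ 0ℚ →
  ∀ t k → val p t k ≡ 0ℚ
determined i w p sup ann e₀ = vanishes w p sup ann e₀ (starts-at-zero i w p sup ann e₀)

-- Padded sequences, partial sums and denominators

-- Padding with zeros makes nonnegativity of the last part one more difference condition, so that a
-- and b need no special case at the end.
ext : ∀ {n} → (Fin n → ℚ) → ℕ → ℚ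
ext {zero} f k = 0ℚ
ext {suc n} f zero = f zero
ext {suc n} f (suc k) = ext (f ∘ suc) k

ext-beyond : ∀ {n} (f : Fin n → ℚ) k → n ℕ.≤ k → ext f k ≡ 0ℚ
ext-beyond {zero} f k h = refl
ext-beyond {suc n} f (suc k) (ℕ.s≤s h) = ext-beyond (f ∘ suc) k h

ext-toℕ : ∀ {n} (f : Fin n → ℚ) i → ext f (toℕ i) ≡ f i
ext-toℕ f zero = refl
ext-toℕ f (suc i) = ext-toℕ (f ∘ suc) i

ext-cong : ∀ {n} {f g : Fin n → ℚ} → (∀ i → f i ≡ g i) → ∀ k → ext f k ≡ ext g k
ext-cong {zero} h k = refl
ext-cong {suc n} h zero = h zero
ext-cong {suc n} h (suc k) = ext-cong (h ∘ suc) k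

ext-restrict : ∀ n (g : ℕ → ℚ) → (∀ k → n ℕ.≤ k → g k ≡ 0ℚ) → ∀ k → ext {n} (g ∘ toℕ) k ≡ g k
ext-restrict zero g h k = sym (h k ℕ.z≤n)
ext-restrict (suc n) g h zero = refl
ext-restrict (suc n) g h (suc k) = ext-restrict n (g ∘ suc) (λ k le → h (suc k) (ℕ.s≤s le)) k

antitone : ∀ (g : ℕ → ℚ) → (∀ k → 0ℚ ≤ g k - g (suc k)) → ∀ k j → g (k ℕ.+ j) ≤ g k
antitone g h k zero = ℚP.≤-reflexive (cong g (ℕP.+-identityʳ k))
antitone g h k (suc j) = ≤-trans (antitone g h (suc k) j ∘≡ ℕP.+-suc k j) (0≤-⇒≤ {g (suc k)} {g k} (h k))
  where
  _∘≡_ : ∀ {a b x} → g a ≤ x → b ≡ a → g b ≤ x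
  le ∘≡ refl = le

constant : ∀ (g : ℕ → ℚ) → (∀ k → g k - g (suc k) ≡ 0ℚ) → ∀ k j → g k ≡ g (k ℕ.+ j)
constant g h k zero = cong g (sym (ℕP.+-identityʳ k))
constant g h k (suc j) = trans (-≡0⇒≡ {g k} {g (suc k)} (h k))
  (trans (constant g h (suc k) j) (cong g (sym (ℕP.+-suc k j))))

sum-upto : (ℕ → ℚ) → ℕ → ℚ
sum-upto g zero = 0ℚ
sum-upto g (suc k) = g 0 + sum-upto (g ∘ suc) k

sum-upto-last : ∀ g k → sum-upto g (suc k) ≡ sum-upto g k + g k
sum-upto-last g zero = trans (ℚP.+-identityʳ (g 0)) (sym (ℚP.+-identityˡ (g 0)))
sum-upto-last g (suc k) = trans (cong (g 0 +_) (sum-upto-last (g ∘ suc) k)) (sym (ℚP.+-assoc (g 0) _ _))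

sum-upto-zero : ∀ k → sum-upto (λ _ → 0ℚ) k ≡ 0ℚ
sum-upto-zero zero = refl
sum-upto-zero (suc k) = trans (ℚP.+-identityˡ _) (sum-upto-zero k)

sumℕ-zero : ∀ n → sumℕ {n} (λ _ → 0) ≡ 0
sumℕ-zero zero = refl
sumℕ-zero (suc n) = sumℕ-zero n

partialSum-all : ∀ {n} (f : Fin n → ℕ) → partialSum n f ≡ sumℕ f
partialSum-all {zero} f = refl
partialSum-all {suc n} f = cong (f zero ℕ.+_) (partialSum-all (f ∘ suc))

sum-upto-partialSum : ∀ {n} (f : Fin n → ℕ) k → sum-upto (ext (toℚ ∘ f)) k ≡ toℚ (partialSum k f)
sum-upto-partialSum {zero} f k = sum-upto-zero k
sum-upto-partialSum {suc n} f zero = cong toℚ (sym (sumℕ-zero n))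
sum-upto-partialSum {suc n} f (suc k) =
  trans (cong (toℚ (f zero) +_) (sum-upto-partialSum (f ∘ suc) k))
        (sym (toℚ-+ (f zero) (partialSum k (f ∘ suc))))

ext-nonincreasing : ∀ {n} (f : Fin n → ℕ) → NonIncreasing f → ∀ k → 0ℚ ≤ ext (toℚ ∘ f) k - ext (toℚ ∘ f) (suc k)
ext-nonincreasing {zero} f h k = ≤-refl
ext-nonincreasing {suc zero} f h zero = ≤⇒0≤- {0ℚ} {toℚ (f zero)} (0≤toℚ (f zero))
ext-nonincreasing {suc (suc n)} f h zero =
  ≤⇒0≤- {toℚ (f (suc zero))} {toℚ (f zero)} (toℚ-mono (h zero (suc zero) ℕ.z≤n))
ext-nonincreasing {suc n} f h (suc k) = ext-nonincreasing (f ∘ suc) (λ i j le → h (suc i) (suc j) (ℕ.s≤s le)) k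

nonincreasing-ext : ∀ {n} (f : Fin n → ℕ) → (∀ k → 0ℚ ≤ ext (toℚ ∘ f) k - ext (toℚ ∘ f) (suc k)) → NonIncreasing f
nonincreasing-ext f h i j le with ℕP.m≤n⇒∃[o]m+o≡n le
... | o , e = toℚ-cancel (≤-resp (trans (cong (ext (toℚ ∘ f)) e) (ext-toℕ (toℚ ∘ f) j)) (ext-toℕ (toℚ ∘ f) i)
                (antitone (ext (toℚ ∘ f)) h (toℕ i) o))

δ : ∀ {n} → Fin n → Fin n → ℚ
δ zero zero = 1ℚ
δ zero (suc j) = 0ℚ
δ (suc i) zero = 0ℚ
δ (suc i) (suc j) = δ i j

sumℚ-δ : ∀ {n} i (x : Fin n → ℚ) → sumℚ (λ j → δ i j * x j) ≡ x i
sumℚ-δ {suc n} zero x = trans (cong₂ _+_ (ℚP.*-identityˡ (x zero)) (sumℚ-zero {n} (λ j → ℚP.*-zeroˡ (x (suc j)))))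
  (ℚP.+-identityʳ (x zero))
sumℚ-δ (suc i) x = trans (cong₂ _+_ (ℚP.*-zeroˡ (x zero)) (sumℚ-δ i (x ∘ suc))) (ℚP.+-identityˡ (x (suc i)))

common-denominator : ∀ {n} (f : Fin n → ℚ) → (∀ i → 0ℚ ≤ f i) →
  Σ ℕ λ N → Σ (Fin n → ℕ) λ K → ∀ i → toℚ (suc N) * f i ≡ toℚ (K i)
common-denominator {zero} f h = 0 , (λ ()) , λ ()
common-denominator {suc n} f h with clear-denominator (h zero) | common-denominator (f ∘ suc) (h ∘ suc)
-- Its successor is `suc M ℕ.* suc N` by computation.
... | M , c , e | N , K , e′ = N ℕ.+ M ℕ.* suc N , K′ , ok
  where
  K′ : Fin (suc n) → ℕ
  K′ zero = suc N ℕ.* c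
  K′ (suc i) = suc M ℕ.* K i
  open ≡-Reasoning
  ok : ∀ i → toℚ (suc M ℕ.* suc N) * f i ≡ toℚ (K′ i)
  ok zero = begin
    toℚ (suc M ℕ.* suc N) * f zero ≡⟨ cong (_* f zero) (toℚ-* (suc M) (suc N)) ⟩
    toℚ (suc M) * toℚ (suc N) * f zero
      ≡⟨ solve 3 (λ a b x → a :* b :* x := b :* (a :* x)) refl (toℚ (suc M)) (toℚ (suc N)) (f zero) ⟩
    toℚ (suc N) * (toℚ (suc M) * f zero) ≡⟨ cong (toℚ (suc N) *_) e ⟩
    toℚ (suc N) * toℚ c ≡⟨ toℚ-* (suc N) c ⟨
    toℚ (suc N ℕ.* c) ∎
  ok (suc i) = begin
    toℚ (suc M ℕ.* suc N) * f (suc i) ≡⟨ cong (_* f (suc i)) (toℚ-* (suc M) (suc N)) ⟩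
    toℚ (suc M) * toℚ (suc N) * f (suc i) ≡⟨ ℚP.*-assoc (toℚ (suc M)) (toℚ (suc N)) (f (suc i)) ⟩
    toℚ (suc M) * (toℚ (suc N) * f (suc i)) ≡⟨ cong (toℚ (suc M) *_) (e′ i) ⟩
    toℚ (suc M) * toℚ (K i) ≡⟨ toℚ-* (suc M) (K i) ⟨
    toℚ (suc M ℕ.* K i) ∎

-- The Kostka cone by inequalities

module Polytope (r : ℕ) where

  Point : Set
  Point = Pt r

  on-halves : (P : Fin (r ℕ.+ r) → Set) → (∀ i → P (i ↑ˡ r)) → (∀ i → P (r ↑ʳ i)) → ∀ i → P i
  on-halves P f g i with splitAt r i in eq
  ... | inj₁ j = subst P (FinP.splitAt⁻¹-↑ˡ eq) (f j)
  ... | inj₂ j = subst P (FinP.splitAt⁻¹-↑ʳ eq) (g j)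

  embed-↑ˡ : ∀ (L M : Fin r → ℕ) i → embed L M (i ↑ˡ r) ≡ toℚ (L i)
  embed-↑ˡ L M i rewrite FinP.splitAt-↑ˡ r i r = refl

  embed-↑ʳ : ∀ (L M : Fin r → ℕ) i → embed L M (r ↑ʳ i) ≡ toℚ (M i)
  embed-↑ʳ L M i rewrite FinP.splitAt-↑ʳ r r i = refl

  first second : Point → Fin r → ℚ
  first x i = x (i ↑ˡ r)
  second x i = x (r ↑ʳ i)

  excess : Point → ℕ → ℚ
  excess x zero = 0ℚ
  excess x (suc k) = excess x k + (ext (first x) k - ext (second x) k)

  profile-of : Point → Profile
  profile-of x = record { l = ext (first x) ; m = ext (second x) ; D = excess x ; step = λ k → refl }

  value : Point → Kind → ℕ → ℚ
  value x = val (profile-of x)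

  -- The coefficient vector is stored because faces are exposed by vectors: a functional assembled
  -- from a, b and D yields its vector.
  record Linear (φ : Point → ℚ) : Set where
    constructor linear-by
    field
      vector : Point
      by-dot : ∀ x → φ x ≡ dot {r} vector x
  open Linear public

  linear-zero : Linear (λ _ → 0ℚ)
  linear-zero = linear-by (λ _ → 0ℚ) (λ x → sym (sumℚ-zero {r ℕ.+ r} (λ i → ℚP.*-zeroˡ (x i))))

  linear-+ : ∀ {φ ψ} → Linear φ → Linear ψ → Linear (λ x → φ x + ψ x)
  linear-+ (linear-by c f) (linear-by d g) = linear-by (λ i → c i + d i) (λ x →
    trans (cong₂ _+_ (f x) (g x)) (trans (sym (sumℚ-+ (λ i → c i * x i) (λ i → d i * x i)))
      (sumℚ-cong {r ℕ.+ r} (λ i → sym (ℚP.*-distribʳ-+ (x i) (c i) (d i))))))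

  linear-neg : ∀ {φ} → Linear φ → Linear (λ x → - φ x)
  linear-neg {φ} (linear-by c f) = linear-by (λ i → - 1ℚ * c i) (λ x →
    trans (trans (solve 1 (λ a → :- a := con (- 1ℚ) :* a) refl (φ x)) (cong (- 1ℚ *_) (f x)))
      (trans (sym (sumℚ-*ˡ (- 1ℚ) (λ i → c i * x i)))
        (sumℚ-cong {r ℕ.+ r} (λ i → sym (ℚP.*-assoc (- 1ℚ) (c i) (x i))))))

  linear-coordinate : ∀ i → Linear (λ x → x i)
  linear-coordinate i = linear-by (δ i) (λ x → sym (sumℚ-δ i x))

  linear-ext : ∀ {n} (g : Fin n → Fin (r ℕ.+ r)) k → Linear (λ x → ext (x ∘ g) k)
  linear-ext {zero} g k = linear-zero
  linear-ext {suc n} g zero = linear-coordinate (g zero)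
  linear-ext {suc n} g (suc k) = linear-ext (g ∘ suc) k

  linear-excess : ∀ k → Linear (λ x → excess x k)
  linear-excess zero = linear-zero
  linear-excess (suc k) =
    linear-+ (linear-excess k) (linear-+ (linear-ext (_↑ˡ r) k) (linear-neg (linear-ext (r ↑ʳ_) k)))

  linear-value : ∀ t k → Linear (λ x → value x t k)
  linear-value A k = linear-+ (linear-ext (_↑ˡ r) k) (linear-neg (linear-ext (_↑ˡ r) (suc k)))
  linear-value B k = linear-+ (linear-ext (r ↑ʳ_) k) (linear-neg (linear-ext (r ↑ʳ_) (suc k)))
  linear-value Δ k = linear-excess (suc k)

  linear-sum : Linear (sumℚ {r ℕ.+ r})
  linear-sum = linear-by (λ _ → 1ℚ) (λ x → sumℚ-cong {r ℕ.+ r} (λ i → sym (ℚP.*-identityˡ (x i))))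

  linear-dot : ∀ c → Linear (dot {r} c)
  linear-dot c = linear-by c (λ x → refl)

  combination : ∀ {φ} → Linear φ → ∀ {k} (α : Fin k → ℚ) (p : Fin k → Point) x →
    (∀ i → x i ≡ sumℚ (λ j → α j * p j i)) → φ x ≡ sumℚ (λ j → α j * φ (p j))
  combination {φ} (linear-by c f) α p x h = begin
    φ x                                              ≡⟨ f x ⟩
    sumℚ (λ i → c i * x i)                           ≡⟨ sumℚ-cong {r ℕ.+ r} (λ i → cong (c i *_) (h i)) ⟩
    sumℚ (λ i → c i * sumℚ (λ j → α j * p j i))      ≡⟨ sumℚ-cong {r ℕ.+ r} (λ i → sumℚ-*ˡ (c i) (λ j → α j * p j i)) ⟨
    sumℚ (λ i → sumℚ (λ j → c i * (α j * p j i)))    ≡⟨ sumℚ-swap (λ i j → c i * (α j * p j i)) ⟩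
    sumℚ (λ j → sumℚ (λ i → c i * (α j * p j i)))
      ≡⟨ sumℚ-cong (λ j → sumℚ-cong {r ℕ.+ r} (λ i →
           solve 3 (λ a b c → a :* (b :* c) := b :* (a :* c)) refl (c i) (α j) (p j i))) ⟩
    sumℚ (λ j → sumℚ (λ i → α j * (c i * p j i)))    ≡⟨ sumℚ-cong (λ j → sumℚ-*ˡ (α j) (λ i → c i * p j i)) ⟩
    sumℚ (λ j → α j * dot {r} c (p j))               ≡⟨ sumℚ-cong (λ j → cong (α j *_) (f (p j))) ⟨
    sumℚ (λ j → α j * φ (p j))                       ∎
    where open ≡-Reasoning

  linear-scale : ∀ {φ} → Linear φ → ∀ t x y → (∀ i → y i ≡ t * x i) → φ y ≡ t * φ x
  linear-scale {φ} L t x y h = trans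
    (combination L {1} (λ _ → t) (λ _ → x) y (λ i → trans (h i) (sym (ℚP.+-identityʳ (t * x i)))))
    (ℚP.+-identityʳ (t * φ x))

  linear-≡0 : ∀ {φ} → Linear φ → ∀ x → (∀ i → x i ≡ 0ℚ) → φ x ≡ 0ℚ
  linear-≡0 (linear-by c f) x h =
    trans (f x) (sumℚ-zero {r ℕ.+ r} (λ i → trans (cong (c i *_) (h i)) (ℚP.*-zeroʳ (c i))))

  -- The description of the Kostka cone by inequalities; `polytope⇒cone` and `cone⇒polytope` compare
  -- it with the convex hull.
  InCone : Point → Set
  InCone x = Nonneg (profile-of x) × excess x r ≡ 0ℚ

  excess-≡ : ∀ x k → excess x k ≡ sum-upto (ext (first x)) k - sum-upto (ext (second x)) k
  excess-≡ x zero = refl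
  excess-≡ x (suc k) = begin
    excess x k + (a - b)  ≡⟨ cong (_+ (a - b)) (excess-≡ x k) ⟩
    (S - T) + (a - b)     ≡⟨ solve 4 (λ S T a b → (S :- T) :+ (a :- b) := (S :+ a) :- (T :+ b)) refl S T a b ⟩
    (S + a) - (T + b)     ≡⟨ cong₂ _-_ (sum-upto-last (ext (first x)) k) (sum-upto-last (ext (second x)) k) ⟨
    sum-upto (ext (first x)) (suc k) - sum-upto (ext (second x)) (suc k) ∎
    where
    open ≡-Reasoning
    S = sum-upto (ext (first x)) k
    T = sum-upto (ext (second x)) k
    a = ext (first x) k
    b = ext (second x) k

  excess-beyond : ∀ x k → r ℕ.≤ k → excess x k ≡ excess x r
  excess-beyond x k le with ℕP.m≤n⇒∃[o]m+o≡n le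
  ... | o , refl = go o
    where
    go : ∀ o → excess x (r ℕ.+ o) ≡ excess x r
    go zero = cong (excess x) (ℕP.+-identityʳ r)
    go (suc o) = begin
      excess x (r ℕ.+ suc o) ≡⟨ cong (excess x) (ℕP.+-suc r o) ⟩
      excess x (r ℕ.+ o) + (ext (first x) (r ℕ.+ o) - ext (second x) (r ℕ.+ o))
        ≡⟨ cong (excess x (r ℕ.+ o) +_) (cong₂ _-_ (ext-beyond (first x) _ (ℕP.m≤m+n r o)) (ext-beyond (second x) _ (ℕP.m≤m+n r o))) ⟩
      excess x (r ℕ.+ o) + 0ℚ ≡⟨ ℚP.+-identityʳ _ ⟩
      excess x (r ℕ.+ o) ≡⟨ go o ⟩
      excess x r ∎
      where open ≡-Reasoning

  cone-vanishes : ∀ {x} → InCone x → Vanishes-from r (profile-of x)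
  cone-vanishes {x} (_ , e) = e , go
    where
    go : ∀ t k → r ℕ.≤ k → value x t k ≡ 0ℚ
    go A k le = cong₂ _-_ (ext-beyond (first x) k le) (ext-beyond (first x) (suc k) (ℕP.m≤n⇒m≤1+n le))
    go B k le = cong₂ _-_ (ext-beyond (second x) k le) (ext-beyond (second x) (suc k) (ℕP.m≤n⇒m≤1+n le))
    go Δ k le = trans (excess-beyond x (suc k) (ℕP.m≤n⇒m≤1+n le)) e

  cone-scale : ∀ {x y} t → 0ℚ ≤ t → (∀ i → y i ≡ t * x i) → InCone x → InCone y
  cone-scale {x} {y} t ht h (nn , e) =
    (λ κ k → ≤-resp refl (sym (linear-scale (linear-value κ k) t x y h)) (0≤-* ht (nn κ k))) ,
    trans (linear-scale (linear-excess r) t x y h) (trans (cong (t *_) e) (ℚP.*-zeroʳ t))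

  -- Each entry is at least the one `r` places further on, which is padding.
  cone-nonneg : ∀ {x} → InCone x → ∀ i → 0ℚ ≤ x i
  cone-nonneg {x} (nn , _) = on-halves (λ i → 0ℚ ≤ x i) (half (first x) (nn A)) (half (second x) (nn B))
    where
    half : ∀ (f : Fin r → ℚ) → (∀ k → 0ℚ ≤ ext f k - ext f (suc k)) → ∀ i → 0ℚ ≤ f i
    half f h i = ≤-resp (ext-beyond f (toℕ i ℕ.+ r) (ℕP.m≤n+m r (toℕ i))) (ext-toℕ f i) (antitone (ext f) h (toℕ i) r)

  values-zero : ∀ x → (∀ t k → value x t k ≡ 0ℚ) → ∀ i → x i ≡ 0ℚ
  values-zero x h = on-halves (λ i → x i ≡ 0ℚ) (half (first x) (h A)) (half (second x) (h B))
    where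
    half : ∀ (f : Fin r → ℚ) → (∀ k → ext f k - ext f (suc k) ≡ 0ℚ) → ∀ i → f i ≡ 0ℚ
    half f h i = trans (sym (ext-toℕ f i))
      (trans (constant (ext f) h (toℕ i) r) (ext-beyond f (toℕ i ℕ.+ r) (ℕP.m≤n+m r (toℕ i))))

  generator⇒cone : ∀ {x} → KostkaGenerator r x → InCone x
  generator⇒cone {x} (L , M , nL , nM , sums , dom , eq) = nn , total
    where
    first≡ : ∀ k → ext (first x) k ≡ ext (toℚ ∘ L) k
    first≡ = ext-cong (λ i → trans (eq (i ↑ˡ r)) (embed-↑ˡ L M i))
    second≡ : ∀ k → ext (second x) k ≡ ext (toℚ ∘ M) k
    second≡ = ext-cong (λ i → trans (eq (r ↑ʳ i)) (embed-↑ʳ L M i))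
    sum-cong : ∀ {f g : ℕ → ℚ} → (∀ k → f k ≡ g k) → ∀ k → sum-upto f k ≡ sum-upto g k
    sum-cong h zero = refl
    sum-cong h (suc k) = cong₂ _+_ (h 0) (sum-cong (h ∘ suc) k)
    D≡ : ∀ k → excess x k ≡ toℚ (partialSum k L) - toℚ (partialSum k M)
    D≡ k = trans (excess-≡ x k) (cong₂ _-_
      (trans (sum-cong first≡ k) (sum-upto-partialSum L k))
      (trans (sum-cong second≡ k) (sum-upto-partialSum M k)))
    total : excess x r ≡ 0ℚ
    total = trans (D≡ r) (≡⇒-≡0 (cong toℚ (trans (partialSum-all L) (trans sums (sym (partialSum-all M))))))
    nn : Nonneg (profile-of x)
    nn A k = ≤-resp refl (sym (cong₂ _-_ (first≡ k) (first≡ (suc k)))) (ext-nonincreasing L nL k)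
    nn B k = ≤-resp refl (sym (cong₂ _-_ (second≡ k) (second≡ (suc k)))) (ext-nonincreasing M nM k)
    nn Δ k with ℕP.≤-total (suc k) r
    ... | inj₁ le = ≤-resp refl (sym (D≡ (suc k))) (≤⇒0≤- (toℚ-mono (dom (suc k) le)))
    ... | inj₂ ge = ℚP.≤-reflexive (sym (trans (excess-beyond x (suc k) ge) total))

  polytope⇒cone : ∀ {x} → KostkaPolytope r x → InCone x
  polytope⇒cone {x} ((k , p , w , w≥0 , _ , gen , eq) , _) =
    (λ t j → ≤-resp refl (sym (combination (linear-value t j) w p x eq))
       (sumℚ-nonneg (λ i → 0≤-* (w≥0 i) (proj₁ (generator⇒cone (gen i)) t j)))) ,
    trans (combination (linear-excess r) w p x eq)
      (sumℚ-zero (λ i → trans (cong (w i *_) (proj₂ (generator⇒cone (gen i)))) (ℚP.*-zeroʳ (w i))))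

  cone⇒generator : ∀ (K : Fin (r ℕ.+ r) → ℕ) → InCone (toℚ ∘ K) → KostkaGenerator r (toℚ ∘ K)
  cone⇒generator K (nn , total) = L , M , nonincreasing-ext L (nn A) , nonincreasing-ext M (nn B) ,
      trans (sym (partialSum-all L)) (trans (toℚ-injective (-≡0⇒≡ (trans (sym (D≡ r)) total))) (partialSum-all M)) ,
      (λ { zero _ → ℕP.≤-reflexive (trans (sumℕ-zero r) (sym (sumℕ-zero r)))
         ; (suc k) _ → toℚ-cancel (0≤-⇒≤ (≤-resp refl (D≡ (suc k)) (nn Δ k))) }) ,
      on-halves (λ i → toℚ (K i) ≡ embed L M i) (λ i → sym (embed-↑ˡ L M i)) (λ i → sym (embed-↑ʳ L M i))
    where
    L M : Fin r → ℕ
    L i = K (i ↑ˡ r)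
    M i = K (r ↑ʳ i)
    D≡ : ∀ k → excess (toℚ ∘ K) k ≡ toℚ (partialSum k L) - toℚ (partialSum k M)
    D≡ k = trans (excess-≡ (toℚ ∘ K) k) (cong₂ _-_ (sum-upto-partialSum L k) (sum-upto-partialSum M k))

  -- A common denominator turns x into an integral multiple that is itself a generator, and x lies
  -- on the segment from that generator to the origin, which is a generator too.
  cone⇒polytope : ∀ {x} → InCone x → sumℚ {r ℕ.+ r} x ≡ 1ℚ → KostkaPolytope r x
  cone⇒polytope {x} cone total with common-denominator x (cone-nonneg cone)
  ... | N , K , e with inverse-pos (0<toℚ-suc N)
  ... | ι , 0<ι , ιN = (2 , p , w , w≥0 , w-sum , gen , combine) , total
    where
    p : Fin 2 → Point
    p zero = toℚ ∘ K
    p (suc _) = toℚ ∘ (λ _ → 0)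
    w : Fin 2 → ℚ
    w zero = ι
    w (suc _) = 1ℚ - ι
    ι≤1 : ι ≤ 1ℚ
    ι≤1 = ≤-resp (ℚP.*-identityʳ ι) ιN
      (ℚP.*-monoˡ-≤-nonNeg ι {{ℚ.nonNegative (<⇒≤ 0<ι)}} (toℚ-mono {1} {suc N} (ℕ.s≤s ℕ.z≤n)))
    w≥0 : ∀ j → 0ℚ ≤ w j
    w≥0 zero = <⇒≤ 0<ι
    w≥0 (suc _) = ≤⇒0≤- {ι} {1ℚ} ι≤1
    w-sum : ι + ((1ℚ - ι) + 0ℚ) ≡ 1ℚ
    w-sum = solve 1 (λ ι → ι :+ ((con 1ℚ :- ι) :+ con 0ℚ) := con 1ℚ) refl ι
    gen : ∀ j → KostkaGenerator r (p j)
    gen zero = cone⇒generator K (cone-scale {x} (toℚ (suc N)) (0≤toℚ (suc N)) (λ i → sym (e i)) cone)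
    gen (suc _) = cone⇒generator (λ _ → 0) (cone-scale {x} 0ℚ ≤-refl (λ i → sym (ℚP.*-zeroˡ (x i))) cone)
    combine : ∀ i → x i ≡ ι * toℚ (K i) + ((1ℚ - ι) * 0ℚ + 0ℚ)
    combine i = sym (begin
      ι * toℚ (K i) + ((1ℚ - ι) * 0ℚ + 0ℚ)
        ≡⟨ solve 2 (λ ι k → ι :* k :+ ((con 1ℚ :- ι) :* con 0ℚ :+ con 0ℚ) := ι :* k) refl ι (toℚ (K i)) ⟩
      ι * toℚ (K i) ≡⟨ cong (ι *_) (e i) ⟨
      ι * (toℚ (suc N) * x i) ≡⟨ ℚP.*-assoc ι (toℚ (suc N)) (x i) ⟨
      ι * toℚ (suc N) * x i ≡⟨ cong (_* x i) ιN ⟩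
      1ℚ * x i ≡⟨ ℚP.*-identityˡ (x i) ⟩
      x i ∎)
      where open ≡-Reasoning

-- The face of a word and its dimension

all-false⇒weight≡0 : ∀ {s n} (w : Word s n) → (∀ t k → flags w t k ≡ false) → weight w ≡ 0
all-false⇒weight≡0 [] h = refl
all-false⇒weight≡0 (ℓ ∷ w) h
  rewrite h A 0 | h B 0 = all-false⇒weight≡0 w (λ t k → h t (suc k))

starts-injective : ∀ {r s s′} (i : Initial s) (i′ : Initial s′) (w : Word s r) (w′ : Word s′ r) →
  (∀ t k → flags w t k ≡ flags w′ t k) → _≡_ {A = Start r} (s , i , w) (s′ , i′ , w′)
starts-injective out out w w′ h = cong from-Out (flags-injective w w′ h)
starts-injective in₀ in₀ w w′ h = cong from-In₀ (flags-injective w w′ h)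
starts-injective out in₀ w w′ h = ⊥-elim (flags-Out≢In₀ w w′ h)
starts-injective in₀ out w w′ h = ⊥-elim (flags-Out≢In₀ w′ w (λ t k → sym (h t k)))

Is⇒0≤ : ∀ b {q} → Is b q → 0ℚ ≤ q
Is⇒0≤ true h = <⇒≤ h
Is⇒0≤ false h = ℚP.≤-reflexive (sym h)

Is-false : ∀ {b q} → b ≡ false → Is b q → q ≡ 0ℚ
Is-false refl h = h

Is-true : ∀ {b q} → b ≡ true → Is b q → 0ℚ < q
Is-true refl h = h

Is-zero⇒false : ∀ b {q} → Is b q → q ≡ 0ℚ → b ≡ false
Is-zero⇒false true h e = ⊥-elim (0<⇒≢0 h e)
Is-zero⇒false false h e = refl

false-iff⇒≡ : ∀ {b c} → (b ≡ false → c ≡ false) → (c ≡ false → b ≡ false) → b ≡ c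
false-iff⇒≡ {false} f g = sym (f refl)
false-iff⇒≡ {true} {true} f g = refl
false-iff⇒≡ {true} {false} f g = g refl

module Faces (r : ℕ) where
  open Polytope r

  point-of : ∀ {s} → Initial s → (w : Word s r) → Σ Point λ x → InCone x × Matches w (profile-of x)
  point-of i w = x , (nonneg , total) , fits
    where
    p = profile (proj₁ (realise i w))
    D₀ : D p 0 ≡ 0ℚ
    D₀ = proj₂ (realise i w)
    fin : Finite r p
    fin = finite (proj₁ (realise i w))
    x : Point
    x j = [ l p ∘ toℕ , m p ∘ toℕ ]′ (splitAt r j)
    l≡ : ∀ k → ext (first x) k ≡ l p k
    l≡ k = trans (ext-cong (λ j → cong [ l p ∘ toℕ , m p ∘ toℕ ]′ (FinP.splitAt-↑ˡ r j r)) k)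
      (ext-restrict r (l p) (λ k le → proj₁ (fin k le)) k)
    m≡ : ∀ k → ext (second x) k ≡ m p k
    m≡ k = trans (ext-cong (λ j → cong [ l p ∘ toℕ , m p ∘ toℕ ]′ (FinP.splitAt-↑ʳ r r j)) k)
      (ext-restrict r (m p) (λ k le → proj₂ (fin k le)) k)
    D≡ : ∀ k → excess x k ≡ D p k
    D≡ zero = sym D₀
    D≡ (suc k) = trans (cong₂ _+_ (D≡ k) (cong₂ _-_ (l≡ k) (m≡ k))) (sym (step p k))
    val≡ : ∀ t k → val p t k ≡ value x t k
    val≡ A k = sym (cong₂ _-_ (l≡ k) (l≡ (suc k)))
    val≡ B k = sym (cong₂ _-_ (m≡ k) (m≡ (suc k)))
    val≡ Δ k = sym (D≡ (suc k))
    fits : Matches w (profile-of x)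
    fits t k = Is-resp (flags w t k) (val≡ t k) (matches (proj₁ (realise i w)) t k)
    nonneg : Nonneg (profile-of x)
    nonneg t k = Is⇒0≤ (flags w t k) (fits t k)
    total : excess x r ≡ 0ℚ
    -- The Δ flag at index `r` speaks of D at `suc r`, which padding makes equal to D at `r`.
    total = trans (sym (excess-beyond x (suc r) (ℕP.n≤1+n r)))
      (Is-false (flags-beyond w Δ r ℕP.≤-refl) (fits Δ r))

  normalise : ∀ {x} → InCone x → 0ℚ < sumℚ {r ℕ.+ r} x →
    Σ ℚ λ t → 0ℚ < t × t * sumℚ {r ℕ.+ r} x ≡ 1ℚ × KostkaPolytope r (λ i → t * x i)
  normalise {x} cone pos = go (inverse-pos pos)
    where
    go : (Σ ℚ λ t → 0ℚ < t × t * sumℚ {r ℕ.+ r} x ≡ 1ℚ) →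
      Σ ℚ λ t → 0ℚ < t × t * sumℚ {r ℕ.+ r} x ≡ 1ℚ × KostkaPolytope r (λ i → t * x i)
    go (t , 0<t , e) = t , 0<t , e ,
      cone⇒polytope (cone-scale {x} t (<⇒≤ 0<t) (λ _ → refl) cone) (trans (sumℚ-*ˡ t x) e)

  -- The realised point can be scaled to coordinate sum 1 unless it is the origin; the origin would
  -- make all flags false and the weight 0.
  interior-point : ∀ {s} → Initial s → (w : Word s r) → weight w ≢ 0 →
    Σ Point λ x → KostkaPolytope r x × Matches w (profile-of x)
  interior-point i w ne = go (point-of i w)
    where
    go : (Σ Point λ x → InCone x × Matches w (profile-of x)) →
      Σ Point λ x → KostkaPolytope r x × Matches w (profile-of x)
    go (x , cone , fits) = scaled (normalise cone (0≤∧≢0⇒0< (sumℚ-nonneg (cone-nonneg cone)) nonzero))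
      where
      nonzero : sumℚ {r ℕ.+ r} x ≢ 0ℚ
      nonzero e = ne (all-false⇒weight≡0 w (λ t k → Is-zero⇒false (flags w t k) (fits t k)
        (linear-≡0 (linear-value t k) x (sumℚ-nonneg-≡0 (cone-nonneg cone) e))))
      scaled : (Σ ℚ λ t → 0ℚ < t × t * sumℚ {r ℕ.+ r} x ≡ 1ℚ × KostkaPolytope r (λ i → t * x i)) →
        Σ Point λ x → KostkaPolytope r x × Matches w (profile-of x)
      scaled (t , 0<t , _ , P) = (λ i → t * x i) , P , λ κ k →
        Is-resp (flags w κ k) (sym (linear-scale (linear-value κ k) t x (λ i → t * x i) (λ _ → refl)))
          (Is-scale 0<t (flags w κ k) (fits κ k))

  OnFace : ∀ {s} → Word s r → Point → Set
  OnFace w x = KostkaPolytope r x × Supported w (profile-of x)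

  matches⇒supported : ∀ {s n} (w : Word s n) {p} → Matches w p → Supported w p
  matches⇒supported w h t k e = Is-false e (h t k)

  -- The face of w is exposed by minus the sum of the facet functionals vanishing on it.

  penalty : ∀ {s} → Word s r → Kind → ℕ → Point → ℚ
  penalty w t k x = if flags w t k then 0ℚ else value x t k

  penalties : ∀ {s} → Word s r → ℕ → Point → ℚ
  penalties w zero x = 0ℚ
  penalties w (suc n) x = penalties w n x + (penalty w A n x + (penalty w B n x + penalty w Δ n x))

  linear-penalty : ∀ {s} (w : Word s r) t k → Linear (penalty w t k)
  linear-penalty w t k with flags w t k
  ... | true = linear-zero
  ... | false = linear-value t k

  linear-penalties : ∀ {s} (w : Word s r) n → Linear (penalties w n)
  linear-penalties w zero = linear-zero
  linear-penalties w (suc n) = linear-+ (linear-penalties w n)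
    (linear-+ (linear-penalty w A n) (linear-+ (linear-penalty w B n) (linear-penalty w Δ n)))

  penalty-nonneg : ∀ {s} (w : Word s r) t k {x} → InCone x → 0ℚ ≤ penalty w t k x
  penalty-nonneg w t k cone with flags w t k
  ... | true = ≤-refl
  ... | false = proj₁ cone t k

  penalties-nonneg : ∀ {s} (w : Word s r) n {x} → InCone x → 0ℚ ≤ penalties w n x
  penalties-nonneg w zero cone = ≤-refl
  penalties-nonneg w (suc n) {x} cone = 0≤-+ (penalties-nonneg w n {x} cone)
    (0≤-+ (penalty-nonneg w A n {x} cone) (0≤-+ (penalty-nonneg w B n {x} cone) (penalty-nonneg w Δ n {x} cone)))

  supported⇒penalty : ∀ {s} (w : Word s r) t k {x} → Supported w (profile-of x) → penalty w t k x ≡ 0ℚ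
  supported⇒penalty w t k h with flags w t k in e
  ... | true = refl
  ... | false = h t k e

  supported⇒penalties : ∀ {s} (w : Word s r) n {x} → Supported w (profile-of x) → penalties w n x ≡ 0ℚ
  supported⇒penalties w zero h = refl
  supported⇒penalties w (suc n) {x} h = cong₂ _+_ (supported⇒penalties w n {x} h)
    (cong₂ _+_ (supported⇒penalty w A n {x} h)
      (cong₂ _+_ (supported⇒penalty w B n {x} h) (supported⇒penalty w Δ n {x} h)))

  penalty⇒value : ∀ {s} (w : Word s r) t k {x} → penalty w t k x ≡ 0ℚ → flags w t k ≡ false → value x t k ≡ 0ℚ
  penalty⇒value w t k e f rewrite f = e

  penalties⇒supported : ∀ {s} (w : Word s r) {x} → InCone x → penalties w r x ≡ 0ℚ → Supported w (profile-of x)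
  penalties⇒supported w {x} cone e t k f with ℕP.<-≤-connex k r
  -- Only indices below `r` are penalised; beyond them all values of a cone point vanish.
  ... | inj₂ le = proj₂ (cone-vanishes {x} cone) t k le
  ... | inj₁ lt = penalty⇒value w t k {x} (go r lt e t) f
    where
    parts : ∀ n → penalties w (suc n) x ≡ 0ℚ → ∀ t → penalty w t n x ≡ 0ℚ
    parts n e = λ { A → sum≡0ˡ hA hBΔ eABΔ ; B → sum≡0ˡ hB hΔ (sum≡0ʳ hA hBΔ eABΔ)
                  ; Δ → sum≡0ʳ hB hΔ (sum≡0ʳ hA hBΔ eABΔ) }
      where
      hA = penalty-nonneg w A n {x} cone
      hB = penalty-nonneg w B n {x} cone
      hΔ = penalty-nonneg w Δ n {x} cone
      hBΔ = 0≤-+ hB hΔ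
      eABΔ = sum≡0ʳ (penalties-nonneg w n {x} cone) (0≤-+ hA hBΔ) e
    go : ∀ n → k ℕ.< n → penalties w n x ≡ 0ℚ → ∀ t → penalty w t k x ≡ 0ℚ
    go (suc n) lt e t with k ℕP.≟ n
    ... | yes refl = parts n e t
    ... | no ne = go n (ℕP.≤∧≢⇒< (ℕP.≤-pred lt) ne)
      (sum≡0ˡ (penalties-nonneg w n {x} cone) (0≤-+ (penalty-nonneg w A n {x} cone)
        (0≤-+ (penalty-nonneg w B n {x} cone) (penalty-nonneg w Δ n {x} cone))) e) t

  exposing : ∀ {s} → Word s r → Point
  exposing w = vector (linear-neg (linear-penalties w r))

  exposing-dot : ∀ {s} (w : Word s r) x → dot {r} (exposing w) x ≡ - penalties w r x
  exposing-dot w x = sym (by-dot (linear-neg (linear-penalties w r)) x)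

  -- The interior point has penalty 0, so the maximum of the exposing functional is 0 and every
  -- maximiser has penalty 0.
  face⇒onFace : ∀ {s} → Initial s → (w : Word s r) → weight w ≢ 0 → ∀ x → Face r (exposing w) x → OnFace w x
  face⇒onFace i w ne x (P , max) = P , penalties⇒supported w {x} (polytope⇒cone P)
      (ℚP.≤-antisym (neg-≤0 (≤-resp top (exposing-dot w x) (max (proj₁ ip) (proj₁ (proj₂ ip)))))
        (penalties-nonneg w r {x} (polytope⇒cone P)))
    where
    ip = interior-point i w ne
    top : dot {r} (exposing w) (proj₁ ip) ≡ 0ℚ
    top = trans (exposing-dot w (proj₁ ip))
      (cong -_ (supported⇒penalties w r {proj₁ ip} (matches⇒supported w (proj₂ (proj₂ ip)))))
    neg-≤0 : ∀ {q} → 0ℚ ≤ - q → q ≤ 0ℚ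
    neg-≤0 {q} h = 0≤-⇒≤ {q} {0ℚ} (≤-resp refl (sym (ℚP.+-identityˡ (- q))) h)

  onFace⇒face : ∀ {s} (w : Word s r) x → OnFace w x → Face r (exposing w) x
  onFace⇒face w x (P , sup) = P , λ y Py → ≤-resp (sym (exposing-dot w y))
    (sym (trans (exposing-dot w x) (cong -_ (supported⇒penalties w r {x} sup))))
    (ℚP.neg-antimono-≤ (penalties-nonneg w r {y} (polytope⇒cone Py)))

  cons : ∀ {m} → Point → (Fin m → Point) → Fin (suc m) → Point
  cons y p zero = y
  cons y p (suc j) = p j

  -- Applying φ to an affine relation isolates the coefficient of `y`.
  affine-extend : ∀ {m} {p : Fin (suc m) → Point} {φ} → Linear φ → ∀ y → (∀ j → φ (p j) ≡ 0ℚ) → φ y ≢ 0ℚ →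
    AffinelyIndependent {r} p → AffinelyIndependent {r} (cons y p)
  affine-extend {m} {p} {φ} L y zeros ne indep a sum-a comb = result
    where
    a₀≡0 : a zero ≡ 0ℚ
    a₀≡0 = *≡0⇒≡0 {a zero} {φ y} ne (begin
      a zero * φ y ≡⟨ ℚP.+-identityʳ _ ⟨
      a zero * φ y + 0ℚ
        ≡⟨ cong (a zero * φ y +_) (sumℚ-zero (λ j → trans (cong (a (suc j) *_) (zeros j)) (ℚP.*-zeroʳ (a (suc j))))) ⟨
      a zero * φ y + sumℚ (λ j → a (suc j) * φ (p j))
        ≡⟨ combination L a (cons y p) (λ i → sumℚ (λ j → a j * cons y p j i)) (λ i → refl) ⟨
      φ (λ i → sumℚ (λ j → a j * cons y p j i)) ≡⟨ linear-≡0 L _ comb ⟩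
      0ℚ ∎)
      where open ≡-Reasoning
    result : ∀ j → a j ≡ 0ℚ
    result zero = a₀≡0
    result (suc j) = indep (a ∘ suc)
      (trans (sym (ℚP.+-identityˡ (sumℚ (a ∘ suc)))) (trans (cong (_+ sumℚ (a ∘ suc)) (sym a₀≡0)) sum-a))
      (λ i → trans (sym (ℚP.+-identityˡ (sumℚ (λ j → a (suc j) * p j i))))
        (trans (cong (_+ sumℚ (λ j → a (suc j) * p j i)) (sym (trans (cong (_* y i) a₀≡0) (ℚP.*-zeroˡ (y i))))) (comb i))) j

  affine-tail : ∀ {m} {p : Fin (suc (suc m)) → Point} → AffinelyIndependent {r} p → AffinelyIndependent {r} (p ∘ suc)
  affine-tail {m} {p} indep a sum-a comb j = indep a′
    (trans (ℚP.+-identityˡ (sumℚ a)) sum-a)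
    (λ i → trans (cong₂ _+_ (ℚP.*-zeroˡ (p zero i)) (comb i)) refl) (suc j)
    where
    a′ : Fin (suc (suc m)) → ℚ
    a′ zero = 0ℚ
    a′ (suc j) = a j

  Has : (Point → Set) → ℕ → Set
  Has F d = Σ (Fin (suc d) → Point) λ p → ((j : Fin (suc d)) → F (p j)) × AffinelyIndependent {r} p

  has-≤ : ∀ {F : Point → Set} {d e} → d ℕ.≤ e → Has F e → Has F d
  has-≤ {F} {d} {e} le h with ℕP.m≤n⇒∃[o]m+o≡n le
  ... | o , refl = drop o (subst (Has F) (ℕP.+-comm d o) h)
    where
    drop : ∀ o → Has F (o ℕ.+ d) → Has F d
    drop zero h = h
    drop (suc o) (p , f , indep) = drop o (p ∘ suc , f ∘ suc , affine-tail {p = p} indep)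

  dimension-unique : ∀ {F : Point → Set} {d e} → HasAffineDim {r} F d → HasAffineDim {r} F e → d ≡ e
  dimension-unique {F} {d} {e} (hd , nd) (he , ne) with ℕP.<-cmp d e
  ... | tri< lt _ _ = ⊥-elim (nd (has-≤ {F} lt he))
  ... | tri≈ _ eq _ = eq
  ... | tri> _ _ gt = ⊥-elim (ne (has-≤ {F} gt hd))

  dimension-transfer : ∀ {F G : Point → Set} {d} → (∀ x → F x → G x) → (∀ x → G x → F x) →
    HasAffineDim {r} F d → HasAffineDim {r} G d
  dimension-transfer f g ((p , hp , indep) , no-more) =
    (p , (λ j → f (p j) (hp j)) , indep) , λ (q , hq , indep′) → no-more (q , (λ j → g (q j) (hq j)) , indep′)

  -- Lower bound, by induction along `shrink`: the flag that separates w′ from w is a functional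
  -- vanishing on the smaller face but not at an interior point of the larger one.
  onFace-has : ∀ d {s} → Initial s → (w : Word s r) → weight w ≡ suc d → Has (OnFace w) d
  onFace-has zero i w e = (λ _ → x) , (λ _ → P , matches⇒supported w fits) ,
      λ { a sum-a _ zero → trans (sym (ℚP.+-identityʳ (a zero))) sum-a }
    where
    ip = interior-point i w (λ z → ℕP.1+n≢0 (trans (sym e) z))
    x = proj₁ ip
    P = proj₁ (proj₂ ip)
    fits = proj₂ (proj₂ ip)
  onFace-has (suc d) i w e = go (shrink i w e) (interior-point i w (λ z → ℕP.1+n≢0 (trans (sym e) z)))
    where
    go : (Σ (Word _ r) λ w′ → weight w′ ≡ suc d × w′ ⊏ w) → (Σ Point λ x → KostkaPolytope r x × Matches w (profile-of x)) →
      Has (OnFace w) (suc d)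
    go (w′ , e′ , mk⊏ sub (t , k , on , off)) (y , P , fits) = grow (onFace-has d i w′ e′)
      where
      grow : Has (OnFace w′) d → Has (OnFace w) (suc d)
      grow (p , hp , indep) = cons y p ,
        (λ { zero → P , matches⇒supported w fits
           ; (suc j) → proj₁ (hp j) , λ t k f → proj₂ (hp j) t k (sub t k f) }) ,
        affine-extend {p = p} (linear-value t k) y (λ j → proj₂ (hp j) t k off) (0<⇒≢0 (Is-true on (fits t k))) indep

  supported-combination : ∀ {s} (w : Word s r) {k} (α : Fin k → ℚ) (p : Fin k → Point) →
    (∀ j → Supported w (profile-of (p j))) → Supported w (profile-of (λ i → sumℚ (λ j → α j * p j i)))
  supported-combination w α p h t k f =
    trans (combination (linear-value t k) α p (λ i → sumℚ (λ j → α j * p j i)) (λ i → refl))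
      (sumℚ-zero (λ j → trans (cong (α j *_) (h j t k f)) (ℚP.*-zeroʳ (α j))))

  -- Upper bound: d + 2 coefficients against d + 1 coordinates leave a nonzero α whose combination
  -- of the points has all coordinates 0, hence is the origin.
  onFace-no-more : ∀ d {s} → Initial s → (w : Word s r) → weight w ≡ suc d → ¬ Has (OnFace w) (suc d)
  onFace-no-more d i w e (p , hp , indep) =
    go (dependent rows (ℕP.≤-reflexive (cong suc (trans (length-map row (coordinates w)) (trans (length-coordinates w) e)))))
    where
    row : Kind × ℕ → Fin (suc (suc d)) → ℚ
    row (t , k) j = value (p j) t k
    rows = map row (coordinates w)
    go : ¬ (Σ (Fin (suc (suc d)) → ℚ) λ α → (Σ (Fin (suc (suc d))) λ j → α j ≢ 0ℚ) ×
      All (λ ρ → sumℚ (λ j → α j * ρ j) ≡ 0ℚ) rows)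
    go (α , (j , ne) , kills) = ne (indep α sum-α z≡0 j)
      where
      z : Point
      z i = sumℚ (λ j → α j * p j i)
      annihilated : Annihilated w (profile-of z)
      annihilated = All.map (λ { {t , k} h → trans (combination (linear-value t k) α p z (λ i → refl)) h })
        (AllP.map⁻ kills)
      z≡0 : ∀ i → z i ≡ 0ℚ
      z≡0 = values-zero z (determined i w (profile-of z) (supported-combination w α p (λ j → proj₂ (hp j))) annihilated refl)
      -- All points have coordinate sum 1, so a linear relation among them is an affine one.
      sum-α : sumℚ α ≡ 0ℚ
      sum-α = begin
        sumℚ α ≡⟨ sumℚ-cong (λ j → trans (cong (α j *_) (proj₂ (proj₁ (hp j)))) (ℚP.*-identityʳ (α j))) ⟨
        sumℚ (λ j → α j * sumℚ {r ℕ.+ r} (p j)) ≡⟨ combination linear-sum α p z (λ i → refl) ⟨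
        sumℚ {r ℕ.+ r} z ≡⟨ sumℚ-zero {r ℕ.+ r} z≡0 ⟩
        0ℚ ∎
        where open ≡-Reasoning

  onFace-dimension : ∀ d {s} → Initial s → (w : Word s r) → weight w ≡ suc d → HasAffineDim {r} (OnFace w) d
  onFace-dimension d i w e = onFace-has d i w e , onFace-no-more d i w e

-- Every face comes from a word

-- Asking for all larger factors as well allows finitely many thresholds to be merged by adding
-- them.
Dominated : ℚ → ℚ → Set
Dominated a b = Σ ℚ λ T → 0ℚ ≤ T × (∀ T′ → T ≤ T′ → a ≤ T′ * b)

dominated : ∀ {a b} → 0ℚ ≤ b → (b ≡ 0ℚ → a ≡ 0ℚ) → 0ℚ ≤ a → Dominated a b
dominated {a} {b} hb imp ha = go (0≤⇒≡0⊎0< hb)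
  where
  go : b ≡ 0ℚ ⊎ 0ℚ < b → Dominated a b
  go (inj₁ e) = 0ℚ , ≤-refl , λ T _ → ℚP.≤-reflexive (trans (imp e) (sym (trans (cong (T *_) e) (ℚP.*-zeroʳ T))))
  go (inj₂ pos) = divide (inverse-pos pos)
    where
    divide : (Σ ℚ λ q → 0ℚ < q × q * b ≡ 1ℚ) → Dominated a b
    divide (q , 0<q , qb) = a * q , 0≤-* ha (<⇒≤ 0<q) , λ T′ le →
      ≤-resp (trans (ℚP.*-assoc a q b) (trans (cong (a *_) qb) (ℚP.*-identityʳ a))) refl
        (ℚP.*-monoʳ-≤-nonNeg b {{ℚ.nonNegative hb}} le)

module Exhaustion (r : ℕ) where
  open Polytope r
  open Faces r

  difference : ∀ {φ} → Linear φ → ∀ T x y → φ (λ i → T * x i - y i) ≡ T * φ x - φ y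
  difference {φ} L T x y = trans
    (combination L α p (λ i → T * x i - y i)
      (λ i → solve 3 (λ T a b → T :* a :- b := T :* a :+ ((con (- 1ℚ)) :* b :+ con 0ℚ)) refl T (x i) (y i)))
    (solve 3 (λ T a b → T :* a :+ ((con (- 1ℚ)) :* b :+ con 0ℚ) := T :* a :- b) refl T (φ x) (φ y))
    where
    α : Fin 2 → ℚ
    α zero = T
    α (suc _) = - 1ℚ
    p : Fin 2 → Point
    p zero = x
    p (suc _) = y

  -- By scaling to coordinate sum 1; a cone point with coordinate sum 0 is the origin.
  homogenise : ∀ c M → (∀ y → KostkaPolytope r y → dot {r} c y ≤ M) →
    ∀ z → InCone z → dot {r} c z ≤ M * sumℚ {r ℕ.+ r} z
  homogenise c M bound z cone = go (0≤⇒≡0⊎0< (sumℚ-nonneg (cone-nonneg cone)))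
    where
    σ : ℚ
    σ = sumℚ {r ℕ.+ r} z
    go : σ ≡ 0ℚ ⊎ 0ℚ < σ → dot {r} c z ≤ M * σ
    go (inj₁ e) = ℚP.≤-reflexive (trans (linear-≡0 (linear-dot c) z (sumℚ-nonneg-≡0 (cone-nonneg cone) e))
      (sym (trans (cong (M *_) e) (ℚP.*-zeroʳ M))))
    go (inj₂ pos) = scaled (normalise cone pos)
      where
      scaled : (Σ ℚ λ t → 0ℚ < t × t * σ ≡ 1ℚ × KostkaPolytope r (λ i → t * z i)) → dot {r} c z ≤ M * σ
      scaled (t , 0<t , tσ , P) = ≤-resp
        (begin
          dot {r} c (λ i → t * z i) * σ ≡⟨ cong (_* σ) (linear-scale (linear-dot c) t z (λ i → t * z i) (λ _ → refl)) ⟩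
          t * dot {r} c z * σ ≡⟨ solve 3 (λ t d s → t :* d :* s := d :* (t :* s)) refl t (dot {r} c z) σ ⟩
          dot {r} c z * (t * σ) ≡⟨ cong (dot {r} c z *_) tσ ⟩
          dot {r} c z * 1ℚ ≡⟨ ℚP.*-identityʳ _ ⟩
          dot {r} c z ∎)
        refl (ℚP.*-monoʳ-≤-nonNeg σ {{ℚ.nonNegative (<⇒≤ pos)}} (bound (λ i → t * z i) P))
        where open ≡-Reasoning

  dominating : ∀ {x y} → InCone x → InCone y → (∀ t k → value x t k ≡ 0ℚ → value y t k ≡ 0ℚ) →
    Σ ℚ λ T → ∀ t k → value y t k ≤ T * value x t k
  dominating {x} {y} cx cy imp = conclude (upto r)
    where
    Bound : ℕ → Set
    Bound n = Σ ℚ λ T → 0ℚ ≤ T × (∀ T′ → T ≤ T′ → ∀ t k → k ℕ.< n → value y t k ≤ T′ * value x t k)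
    dom : ∀ t k → Dominated (value y t k) (value x t k)
    dom t k = dominated (proj₁ cx t k) (imp t k) (proj₁ cy t k)
    add : ∀ n → Bound n → (∀ t → Dominated (value y t n) (value x t n)) → Bound (suc n)
    add n (T , hT , f) d = T + (T₁ + (T₂ + T₃)) , 0≤-+ hT (0≤-+ h₁ (0≤-+ h₂ h₃)) , g
      where
      T₁ = proj₁ (d A)
      T₂ = proj₁ (d B)
      T₃ = proj₁ (d Δ)
      h₁ = proj₁ (proj₂ (d A))
      h₂ = proj₁ (proj₂ (d B))
      h₃ = proj₁ (proj₂ (d Δ))
      left : ∀ {p q} → 0ℚ ≤ q → p ≤ p + q
      left {p} hq = ≤-resp (ℚP.+-identityʳ p) refl (ℚP.+-monoʳ-≤ p hq)
      right : ∀ {p q} → 0ℚ ≤ p → q ≤ p + q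
      right {p} {q} hp = ≤-resp (ℚP.+-identityˡ q) refl (ℚP.+-monoˡ-≤ q hp)
      g : ∀ T′ → T + (T₁ + (T₂ + T₃)) ≤ T′ → ∀ t k → k ℕ.< suc n → value y t k ≤ T′ * value x t k
      g T′ le t k lt with k ℕP.≟ n
      ... | no ne = f T′ (≤-trans (left (0≤-+ h₁ (0≤-+ h₂ h₃))) le) t k (ℕP.≤∧≢⇒< (ℕP.≤-pred lt) ne)
      g T′ le A k lt | yes refl = proj₂ (proj₂ (d A)) T′ (≤-trans (≤-trans (left (0≤-+ h₂ h₃)) (right hT)) le)
      g T′ le B k lt | yes refl = proj₂ (proj₂ (d B)) T′ (≤-trans (≤-trans (≤-trans (left h₃) (right h₁)) (right hT)) le)
      g T′ le Δ k lt | yes refl = proj₂ (proj₂ (d Δ)) T′ (≤-trans (≤-trans (≤-trans (right h₂) (right h₁)) (right hT)) le)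
    upto : ∀ n → Bound n
    upto zero = 0ℚ , ≤-refl , λ _ _ _ _ ()
    upto (suc n) = add n (upto n) (λ t → dom t n)
    conclude : Bound r → Σ ℚ λ T → ∀ t k → value y t k ≤ T * value x t k
    conclude (T , _ , f) = T , g
      where
      g : ∀ t k → value y t k ≤ T * value x t k
      g t k with ℕP.<-≤-connex k r
      ... | inj₁ lt = f T ≤-refl t k lt
      ... | inj₂ le = ℚP.≤-reflexive (trans (proj₂ (cone-vanishes {y} cy) t k le)
        (sym (trans (cong (T *_) (proj₂ (cone-vanishes {x} cx) t k le)) (ℚP.*-zeroʳ T))))

  -- The sum X of spanning points of the face has maximal support on it: a point of
  -- the face with larger support would be affinely independent of them.  Conversely
  -- if the support of y lies in that of X, then T X − y is in the cone for large T,
  -- which forces y to be maximal too.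
  face-is-onFace : ∀ d c → IsDFace r d c → Σ State λ s → Initial s × (Σ (Word s r) λ w → weight w ≢ 0 ×
    (∀ y → Face r c y → OnFace w y) × (∀ y → OnFace w y → Face r c y))
  face-is-onFace d c ((p , hp , indep) , no-more) = go (classify r (profile-of X) (proj₁ X-cone) (cone-vanishes {X} X-cone) refl)
    where
    X : Point
    -- The factor 1 brings X into the form of `combination`. X is not normalised: its coordinate sum
    -- is `n`, that is d + 1.
    X i = sumℚ (λ j → 1ℚ * p j i)
    p-cone : ∀ j → InCone (p j)
    p-cone j = polytope⇒cone (proj₁ (hp j))
    X-φ : ∀ {φ} → Linear φ → φ X ≡ sumℚ (λ j → φ (p j))
    X-φ {φ} L = trans (combination L (λ _ → 1ℚ) p X (λ i → refl)) (sumℚ-cong (λ j → ℚP.*-identityˡ (φ (p j))))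
    X-cone : InCone X
    X-cone = (λ t k → ≤-resp refl (sym (X-φ (linear-value t k))) (sumℚ-nonneg (λ j → proj₁ (p-cone j) t k))) ,
      trans (X-φ (linear-excess r)) (sumℚ-zero (λ j → proj₂ (p-cone j)))
    M : ℚ
    M = dot {r} c (p zero)
    bound : ∀ y → KostkaPolytope r y → dot {r} c y ≤ M
    bound = proj₂ (hp zero)
    n : ℚ
    n = sumℚ {suc d} (λ _ → 1ℚ)
    σX : sumℚ {r ℕ.+ r} X ≡ n
    σX = trans (X-φ linear-sum) (sumℚ-cong (λ j → proj₂ (proj₁ (hp j))))
    cX : dot {r} c X ≡ M * n
    cX = trans (X-φ (linear-dot c)) (trans
      (sumℚ-cong (λ j → trans (ℚP.≤-antisym (bound (p j) (proj₁ (hp j))) (proj₂ (hp j) (p zero) (proj₁ (hp zero))))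
        (sym (ℚP.*-identityʳ M))))
      (sumℚ-*ˡ {suc d} M (λ _ → 1ℚ)))
    go : (Σ State λ s → Initial s × (Σ (Word s r) λ w → Matches w (profile-of X))) →
      Σ State λ s → Initial s × (Σ (Word s r) λ w → weight w ≢ 0 ×
        (∀ y → Face r c y → OnFace w y) × (∀ y → OnFace w y → Face r c y))
    go (s , i , w , fits) = s , i , w , nonzero , into , onto
      where
      p-supported : ∀ j → Supported w (profile-of (p j))
      p-supported j t k f = sumℚ-nonneg-≡0 (λ j → proj₁ (p-cone j) t k)
        (trans (sym (X-φ (linear-value t k))) (Is-false f (fits t k))) j
      nonzero : weight w ≢ 0
      -- Weight 0 leaves no coordinates, so `determined` would make `p zero` the origin, whose
      -- coordinate sum is not 1.
      nonzero e = ℚP.1≢0 (trans (sym (proj₂ (proj₁ (hp zero)))) (sumℚ-zero {r ℕ.+ r} (values-zero (p zero)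
        (determined i w (profile-of (p zero)) (p-supported zero) (empty (coordinates w) (trans (length-coordinates w) e)) refl))))
        where
        empty : ∀ {P : Kind × ℕ → Set} xs → length xs ≡ 0 → All P xs
        empty [] _ = []
      into : ∀ y → Face r c y → OnFace w y
      into y face = proj₁ face , sup
        where
        sup : Supported w (profile-of y)
        sup t k f with value y t k ℚP.≟ 0ℚ
        ... | yes e = e
        ... | no ne = ⊥-elim (no-more (cons y p , (λ { zero → face ; (suc j) → hp j }) ,
          affine-extend {p = p} (linear-value t k) y (λ j → p-supported j t k f) ne indep))
      onto : ∀ y → OnFace w y → Face r c y
      onto y (Py , sup) = Py , λ z Pz → ≤-trans (bound z Pz)
        (large (dominating {X} {y} X-cone (polytope⇒cone Py)
          (λ t k e → sup t k (Is-zero⇒false (flags w t k) (fits t k) e))))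
        where
        large : (Σ ℚ λ T → ∀ t k → value y t k ≤ T * value X t k) → M ≤ dot {r} c y
        -- For Z = T X - y the homogenised bound reads T M n - c·y ≤ M (T n - 1), that is M ≤ c·y.
        large (T , le) = 0≤-⇒≤ {M} {dot {r} c y} (≤-resp refl
          (solve 4 (λ M T n d → M :* (T :* n :- con 1ℚ) :- (T :* (M :* n) :- d) := d :- M) refl M T n (dot {r} c y))
          (≤⇒0≤- (≤-resp cZ (cong (M *_) σZ) (homogenise c M bound Z Z-cone))))
          where
          Z : Point
          Z i = T * X i - y i
          Z-cone : InCone Z
          Z-cone = (λ t k → ≤-resp refl (sym (difference (linear-value t k) T X y)) (≤⇒0≤- (le t k))) ,
            trans (difference (linear-excess r) T X y)
              (trans (cong₂ (λ a b → T * a - b) (proj₂ X-cone) (proj₂ (polytope⇒cone Py)))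
                (solve 1 (λ T → T :* con 0ℚ :- con 0ℚ := con 0ℚ) refl T))
          σZ : sumℚ {r ℕ.+ r} Z ≡ T * n - 1ℚ
          σZ = trans (difference linear-sum T X y) (cong₂ (λ a b → T * a - b) σX (proj₂ Py))
          cZ : dot {r} c Z ≡ T * (M * n) - dot {r} c y
          cZ = trans (difference (linear-dot c) T X y) (cong (λ a → T * a - dot {r} c y) cX)

  number-of-faces : ∀ d → NumDFaces r d (length (starts r (suc d)))
  number-of-faces d = functional , is-face , distinct , exhaustive
    where
    start : Fin (length (starts r (suc d))) → Start r
    start = lookup (starts r (suc d))
    word : ∀ a → Word (proj₁ (start a)) r
    word a = proj₂ (proj₂ (start a))
    initial : ∀ a → Initial (proj₁ (start a))
    initial a = proj₁ (proj₂ (start a))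
    functional : Fin (length (starts r (suc d))) → Point
    functional a = exposing (word a)
    weight≡ : ∀ a → weight (word a) ≡ suc d
    weight≡ a = starts-weight r (suc d) (∈P.∈-lookup {xs = starts r (suc d)} a)
    weight≢0 : ∀ a → weight (word a) ≢ 0
    weight≢0 a e = ℕP.1+n≢0 (trans (sym (weight≡ a)) e)
    is-face : ∀ a → IsDFace r d (functional a)
    is-face a = dimension-transfer (onFace⇒face (word a)) (face⇒onFace (initial a) (word a) (weight≢0 a))
      (onFace-dimension d (initial a) (word a) (weight≡ a))
    -- Inclusion of faces is tested at an interior point of the smaller one, whose zeros are exactly
    -- the false flags of its word.
    contained : ∀ a b → (∀ x → Face r (functional a) x → Face r (functional b) x) →
      ∀ t k → flags (word b) t k ≡ false → flags (word a) t k ≡ false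
    contained a b h t k f = Is-zero⇒false (flags (word a) t k) (fits t k)
      (proj₂ (face⇒onFace (initial b) (word b) (weight≢0 b) x
        (h x (onFace⇒face (word a) x (proj₁ (proj₂ ip) , matches⇒supported (word a) fits)))) t k f)
      where
      ip = interior-point (initial a) (word a) (weight≢0 a)
      x = proj₁ ip
      fits = proj₂ (proj₂ ip)
    distinct : ∀ a b → SameFace r (functional a) (functional b) → a ≡ b
    distinct a b same = lookup-injective (starts-unique r (suc d)) a b
      (starts-injective (initial a) (initial b) (word a) (word b) (λ t k →
        false-iff⇒≡ (contained b a (λ x → proj₂ (same x)) t k) (contained a b (λ x → proj₁ (same x)) t k)))
    exhaustive : ∀ c → IsDFace r d c → ∃ λ a → SameFace r c (functional a)
    exhaustive c hc = go (face-is-onFace d c hc)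
      where
      go : (Σ State λ s → Initial s × (Σ (Word s r) λ w → weight w ≢ 0 ×
        (∀ y → Face r c y → OnFace w y) × (∀ y → OnFace w y → Face r c y))) → ∃ λ a → SameFace r c (functional a)
      go (s , i , w , ne , into , onto) = index mem , λ x →
          (λ h → subst (λ v → Face r (exposing (proj₂ (proj₂ v))) x) at (onFace⇒face w x (into x h))) ,
          (λ h → onto x (face⇒onFace i w ne x (subst (λ v → Face r (exposing (proj₂ (proj₂ v))) x) (sym at) h)))
        where
        weight-w : weight w ≡ suc d
        weight-w = positive (weight w) refl
          where
          positive : ∀ m → weight w ≡ m → weight w ≡ suc d
          positive zero e = ⊥-elim (ne e)
          -- The weight is forced: it gives the face dimension d′, and the dimension is unique.
          positive (suc d′) e = trans e (cong suc
            (dimension-unique {OnFace w} (onFace-dimension d′ i w e) (dimension-transfer into onto hc)))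
        mem : (s , i , w) ∈ starts r (suc d)
        mem = subst (λ m → (s , i , w) ∈ starts r m) weight-w (starts-complete i w)
        at : (s , i , w) ≡ start (index mem)
        at = AnyP.lookup-index mem

theorem1p2 : (r : ℕ) → 1 ℕ.≤ r →
    NumDFaces r 1 (r C 6 ℕ.+ 2 ℕ.* (r C 5) ℕ.+ 6 ℕ.* (r C 4) ℕ.+ 7 ℕ.* (r C 3) ℕ.+ 3 ℕ.* (r C 2))
    × NumDFaces r 2 (r C 9 ℕ.+ 3 ℕ.* (r C 8) ℕ.+ 12 ℕ.* (r C 7) ℕ.+ 23 ℕ.* (r C 6) ℕ.+ 33 ℕ.* (r C 5)
                     ℕ.+ 31 ℕ.* (r C 4) ℕ.+ 13 ℕ.* (r C 3) ℕ.+ r C 2)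
    × NumDFaces r 3 (r C 12 ℕ.+ 4 ℕ.* (r C 11) ℕ.+ 19 ℕ.* (r C 10) ℕ.+ 49 ℕ.* (r C 9) ℕ.+ 105 ℕ.* (r C 8)
                     ℕ.+ 163 ℕ.* (r C 7) ℕ.+ 177 ℕ.* (r C 6) ℕ.+ 131 ℕ.* (r C 5) ℕ.+ 53 ℕ.* (r C 4) ℕ.+ 7 ℕ.* (r C 3))
theorem1p2 r _ = subst (NumDFaces r 1) (count₁ r) (number-of-faces 1) ,
  subst (NumDFaces r 2) (count₂ r) (number-of-faces 2) ,
  subst (NumDFaces r 3) (count₃ r) (number-of-faces 3)
  where open Exhaustion r
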